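{- Let $G=(A,B,E)$ be a bipartite graph with a proper edge coloring $\chi:E\to\{1,\dots,d\}$ and let $k\ge 2$. Then there exists a subgraph $G'=(A,B,E')$ of $G$ that contains no $(k',B)$-slow walk for any $2\le k'\le k$ and satisfies $|E'|>\frac{\log^{(k-1)}d}{4\cdot 240^{k-1}d}|E|$. Similarly, there exists a subgraph $G''=(A,B,E'')$ of $G$ that contains no $k'$-fast walk for any $2\le k'\le k$ and satisfies $|E''|>\frac{\log^{(k-1)}d}{4\cdot 240^{k-1}d}|E|$. (Colors of walks in the subgraphs are taken with respect to $\chi$.)
   Context: A bipartite graph is a triple $G=(A,B,E)$ with disjoint vertex sets $A,B$ and $E\subseteq A\times B$; it is simple. A proper edge coloring assigns colors so that adjacent edges get different colors. A walk of length $m$ is a sequence of vertices $v_0,\dots,v_m$ with $v_{i-1}v_i$ an edge for $1\le i\le m$ and $v_{i-2}\neq v_i$ for $2\le i\le m$ (no immediate backtracking); its coloring is $(\chi(v_0v_1),\dots,\chi(v_{m-1}v_m))$. For $k\ge2$, a $k$-fast walk is a walk of length $2k$ whose coloring $(c_1,\dots,c_{2k})$ satisfies $c_1>c_2>\dots>c_k<c_{k+1}<\dots<c_{2k}$ and $c_1\ge c_{2k}$. For $k\ge 2$, a $k$-slow walk is a walk of length $2k$ whose coloring satisfies: $c_{2j-1}>c_{2j}$ for $1\le j\le k/2$; $c_{2j}<c_{2j+1}$ for $1\le j<k/2$; $c_{2j-1}<c_{2j}$ for $k/2<j\le k$; $c_{2j}>c_{2j+1}$ for $k/2\le j<k$;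 and $c_1\ge c_{2k}$. A $k$-slow walk starting (i.e. with $v_0$) in $B$ is a $(k,B)$-slow walk. $\log$ is the binary logarithm and $\log^{(k)}$ the $k$ times iterated logarithm.
   Formalization: The graph is assumed to have at least one edge (for empty E the strict inequality reads 0 > 0 and fails), and where the iterated logarithm of d is undefined (small d) it is read as minus infinity, so the edge bound then holds trivially. -}

module Defs where

open import Data.Nat using (ℕ; zero; suc; _+_; _*_; _∸_; _^_; _≤_; _<_)
open import Data.Fin using (Fin)
open import Data.Bool using (Bool; true; false; if_then_else_)
open import Data.List using (List; map; allFin)
open import Data.Nat.ListAction using (sum)
open import Data.Sum using (_⊎_; inj₁; inj₂)
open import Data.Product using (Σ; _×_; _,_; ∃)
open import Data.Empty using (⊥)
open import Relation.Binary.PropositionalEquality using (_≡_; _≢_)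
open import Relation.Nullary using (¬_)

EdgeSet : ℕ → ℕ → Set
EdgeSet na nb = Fin na → Fin nb → Bool

edgeCount : ∀ {na nb} → EdgeSet na nb → ℕ
edgeCount {na} {nb} E =
  sum (map (λ x → sum (map (λ y → if E x y then 1 else 0) (allFin nb))) (allFin na))

_⊆ᴱ_ : ∀ {na nb} → EdgeSet na nb → EdgeSet na nb → Set
E' ⊆ᴱ E = ∀ x y → E' x y ≡ true → E x y ≡ true

-- An edge colouring is a function on A × B; only its values on edges matter.
Colouring : ℕ → ℕ → Set
Colouring na nb = Fin na → Fin nb → ℕ

IsProperColouring : ∀ {na nb} → EdgeSet na nb → ℕ → Colouring na nb → Set
IsProperColouring E d χ =
  (∀ x y → E x y ≡ true → 1 ≤ χ x y × χ x y ≤ d)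
  × (∀ x y y' → E x y ≡ true → E x y' ≡ true → y ≢ y' → χ x y ≢ χ x y')
  × (∀ x x' y → E x y ≡ true → E x' y ≡ true → x ≢ x' → χ x y ≢ χ x' y)

Vertex : ℕ → ℕ → Set
Vertex na nb = Fin na ⊎ Fin nb

Adj : ∀ {na nb} → EdgeSet na nb → Vertex na nb → Vertex na nb → Set
Adj E (inj₁ x) (inj₂ y) = E x y ≡ true
Adj E (inj₂ y) (inj₁ x) = E x y ≡ true
Adj E _        _        = ⊥

col : ∀ {na nb} → Colouring na nb → Vertex na nb → Vertex na nb → ℕ
col χ (inj₁ x) (inj₂ y) = χ x y
col χ (inj₂ y) (inj₁ x) = χ x y
col χ _        _        = 0

-- w : ℕ → V with w 0, …, w m a walk of length m in (A,B,E):
-- consecutive vertices adjacent and no immediate backtracking.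
IsWalk : ∀ {na nb} → EdgeSet na nb → ℕ → (ℕ → Vertex na nb) → Set
IsWalk E m w =
  (∀ i → 1 ≤ i → i ≤ m → Adj E (w (i ∸ 1)) (w i))
  × (∀ i → 2 ≤ i → i ≤ m → w (i ∸ 2) ≢ w i)

walkColour : ∀ {na nb} → Colouring na nb → (ℕ → Vertex na nb) → ℕ → ℕ
walkColour χ w i = col χ (w (i ∸ 1)) (w i)

IsFastPattern : ℕ → (ℕ → ℕ) → Set
IsFastPattern k c =
  (∀ i → 1 ≤ i → i < k → c (suc i) < c i)
  × (∀ i → k ≤ i → i < 2 * k → c i < c (suc i))
  × (c (2 * k) ≤ c 1)

-- colour pattern of a k-slow walk; "j ≤ k/2" is written 2j ≤ k etc.
IsSlowPattern : ℕ → (ℕ → ℕ) → Set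
IsSlowPattern k c =
  (∀ j → 1 ≤ j → 2 * j ≤ k → c (2 * j) < c (2 * j ∸ 1))
  × (∀ j → 1 ≤ j → 2 * j < k → c (2 * j) < c (2 * j + 1))
  × (∀ j → k < 2 * j → j ≤ k → c (2 * j ∸ 1) < c (2 * j))
  × (∀ j → k ≤ 2 * j → j < k → c (2 * j + 1) < c (2 * j))
  × (c (2 * k) ≤ c 1)

StartsInB : ∀ {na nb} → Vertex na nb → Set
StartsInB (inj₁ _) = ⊥
StartsInB (inj₂ _) = Data.Unit.⊤
  where import Data.Unit

HasFastWalk : ∀ {na nb} → EdgeSet na nb → Colouring na nb → ℕ → Set
HasFastWalk {na} {nb} E χ k =
  Σ (ℕ → Vertex na nb) λ w → IsWalk E (2 * k) w × IsFastPattern k (walkColour χ w)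

HasSlowBWalk : ∀ {na nb} → EdgeSet na nb → Colouring na nb → ℕ → Set
HasSlowBWalk {na} {nb} E χ k =
  Σ (ℕ → Vertex na nb) λ w →
    StartsInB (w 0) × IsWalk E (2 * k) w × IsSlowPattern k (walkColour χ w)

-- Iterated binary logarithm, compared with a non-negative rational.
--
-- LogLt j x a b  encodes the real statement  log^{(j)} x < a / b
-- (for b ≥ 1), with the convention log t = -∞ for t ≤ 0 (so once an
-- iterate is undefined the inequality holds).  Justification:
--   log^{(0)} x < a/b  ⇔  x·b < a;
--   log^{(j+1)} x < a/b ⇔ log^{(j)} x < 2^{a/b}
--                      ⇔ ∃ rational r = m/n > 0 with log^{(j)} x < r < 2^{a/b},
--   and for m,n,b ≥ 1:  m/n < 2^{a/b} ⇔ m^b < 2^a · n^b.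
LogLt : ℕ → ℕ → ℕ → ℕ → Set
LogLt zero    x a b = x * b < a
LogLt (suc j) x a b =
  ∃ λ m → ∃ λ n → 1 ≤ m × 1 ≤ n × LogLt j x m n × m ^ b < 2 ^ a * n ^ b

{-# OPTIONS --safe #-}
module Submission where

-- A walk of length 2k is read outwards from its middle vertex, along two rays.
-- Call σ-walks those in which the colours increase outwards at the vertices in A,
-- and increase (σ = true) or decrease (σ = false) outwards at the vertices in B,
-- where passing the middle from left to right counts as outwards; these are the fast walks and (starting in B) the slow walks.
--
-- One random thinning step lowers k by one and d to about (log d) / 2.  Write colours
-- in binary, cut them into a high and a low half, and shift the high halves by a
-- random s to get the height of an edge.  Each x ∈ A picks a random number r and puts
-- into class i the edges whose height first differs from r at digit i, with 0 against 1.
-- Each y ∈ B picks a random height, which all its edges must have, and a random low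
-- half ρ, putting into class i the edges whose low half is at distance about 2^(h-1-i)
-- from ρ.  An edge survives if its two ends agree on its class i and no adjacent edge
-- got the same class.  Every i has probability of order 1/d, whence the gain log d.
--
-- The classes form a proper colouring that is order reversing at A.  At B they increase
-- outwards along σ-walks.  Suppose no shorter sub-walk around the middle is a σ-walk for
-- the classes, with A and B exchanged and σ = false.  Then by induction from the middle
-- outwards the right ray stays at least as high as the left one: heights are constant
-- at B, and at A the right ray is raised at a strictly higher digit than the left one.
-- This contradicts c₁ ≥ c₂ₖ.

open import Defs
open import Data.Nat
open import Data.Nat.Properties
open import Data.Nat.DivMod
open import Data.Nat.Divisibility using (divides-refl)
open import Data.Nat.ListAction using (sum)
open import Data.Nat.ListAction.Properties using (sum-++)
open import Data.Nat.Tactic.RingSolver using (solve-∀)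
open import Data.Bool using (Bool; true; false; if_then_else_; _∧_; not)
import Data.Bool as Bool
open import Data.Bool.Properties using (not-injective)
open import Data.Empty using (⊥)
open import Data.Fin using (Fin; zero; suc)
import Data.Fin.Properties as Fin
open import Data.List using (List; []; _∷_; _++_; map; length; upTo; applyUpTo; allFin; cartesianProductWith; cartesianProduct)
open import Data.List.Properties using (length-applyUpTo; length-++; length-map; map-++; map-∘; map-applyUpTo; map-tabulate)
open import Data.List.Membership.Propositional using (_∈_)
open import Data.List.Membership.Propositional.Properties using (∈-upTo⁻; ∈-upTo⁺; ∈-allFin)
open import Data.List.Relation.Unary.Any using (here; there)
open import Data.Product using (Σ; _×_; _,_; proj₁; proj₂; ∃; ∃₂)
open import Data.Sum using (inj₁; inj₂; swap)
open import Data.Vec.Functional using () renaming (_∷_ to _◂_)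
open import Function using (_∘_; id)
open import Relation.Binary.Definitions using (tri<; tri≈; tri>)
open import Relation.Binary.PropositionalEquality
open import Relation.Nullary using (¬_; Dec; yes; no; does; contradiction)
open import Relation.Nullary.Decidable using (dec-true)

private variable
  A B C : Set

-- Finite sums

∑ : List A → (A → ℕ) → ℕ
∑ xs f = sum (map f xs)

𝟙 : Bool → ℕ
𝟙 b = if b then 1 else 0

𝟙≤1 : ∀ b → 𝟙 b ≤ 1
𝟙≤1 true  = ≤-refl
𝟙≤1 false = z≤n

𝟙-∧ : ∀ a b → 𝟙 (a ∧ b) ≡ 𝟙 a * 𝟙 b
𝟙-∧ true  b = sym (*-identityˡ (𝟙 b))
𝟙-∧ false b = refl

∑-cong : ∀ (xs : List A) {f g} → (∀ x → f x ≡ g x) → ∑ xs f ≡ ∑ xs g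
∑-cong []       e = refl
∑-cong (x ∷ xs) e = cong₂ _+_ (e x) (∑-cong xs e)

∑-mono-∈ : ∀ (xs : List A) {f g} → (∀ x → x ∈ xs → f x ≤ g x) → ∑ xs f ≤ ∑ xs g
∑-mono-∈ []       e = z≤n
∑-mono-∈ (x ∷ xs) e = +-mono-≤ (e x (here refl)) (∑-mono-∈ xs (λ z → e z ∘ there))

∑-mono : ∀ (xs : List A) {f g} → (∀ x → f x ≤ g x) → ∑ xs f ≤ ∑ xs g
∑-mono xs e = ∑-mono-∈ xs (λ x _ → e x)

∑-cong-∈ : ∀ (xs : List A) {f g} → (∀ x → x ∈ xs → f x ≡ g x) → ∑ xs f ≡ ∑ xs g
∑-cong-∈ xs e = ≤-antisym (∑-mono-∈ xs (λ x x∈ → ≤-reflexive (e x x∈))) (∑-mono-∈ xs (λ x x∈ → ≤-reflexive (sym (e x x∈))))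

∑-+ : ∀ (xs : List A) f g → ∑ xs (λ x → f x + g x) ≡ ∑ xs f + ∑ xs g
∑-+ []       f g = refl
∑-+ (x ∷ xs) f g = trans (cong (f x + g x +_) (∑-+ xs f g)) (interchange (f x) (g x) _ _)
  where
  interchange : ∀ a b c d → a + b + (c + d) ≡ a + c + (b + d)
  interchange = solve-∀

∑-*ˡ : ∀ (xs : List A) c f → ∑ xs (λ x → c * f x) ≡ c * ∑ xs f
∑-*ˡ []       c f = sym (*-zeroʳ c)
∑-*ˡ (x ∷ xs) c f = trans (cong (c * f x +_) (∑-*ˡ xs c f)) (sym (*-distribˡ-+ c (f x) _))

∑-*ʳ : ∀ (xs : List A) c f → ∑ xs (λ x → f x * c) ≡ ∑ xs f * c
∑-*ʳ xs c f = trans (∑-cong xs (λ x → *-comm (f x) c)) (trans (∑-*ˡ xs c f) (*-comm c _))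

∑-const : ∀ (xs : List A) c → ∑ xs (λ _ → c) ≡ length xs * c
∑-const []       c = refl
∑-const (x ∷ xs) c = cong (c +_) (∑-const xs c)

∑-swap : ∀ (xs : List A) (ys : List B) (f : A → B → ℕ) → ∑ xs (λ x → ∑ ys (f x)) ≡ ∑ ys (λ y → ∑ xs (λ x → f x y))
∑-swap []       ys f = sym (trans (∑-const ys 0) (*-zeroʳ (length ys)))
∑-swap (x ∷ xs) ys f = trans (cong (∑ ys (f x) +_) (∑-swap xs ys f)) (sym (∑-+ ys (f x) _))

∑-member : ∀ {xs : List A} {x} f → x ∈ xs → f x ≤ ∑ xs f
∑-member f (here refl)          = m≤m+n _ _
∑-member {xs = z ∷ _} f (there x∈xs) = ≤-trans (∑-member f x∈xs) (m≤n+m _ (f z))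

∑-++ : ∀ (xs ys : List A) f → ∑ (xs ++ ys) f ≡ ∑ xs f + ∑ ys f
∑-++ xs ys f = trans (cong sum (map-++ f xs ys)) (sum-++ (map f xs) (map f ys))

∑-product : ∀ (g : A → B → C) xs ys f →
  ∑ (cartesianProductWith g xs ys) f ≡ ∑ xs (λ x → ∑ ys (λ y → f (g x y)))
∑-product g []       ys f = refl
∑-product g (x ∷ xs) ys f = trans (∑-++ (map (g x) ys) _ f)
  (cong₂ _+_ (cong sum (sym (map-∘ ys))) (∑-product g xs ys f))

length-product : ∀ (g : A → B → C) xs ys → length (cartesianProductWith g xs ys) ≡ length xs * length ys
length-product g []       ys = refl
length-product g (x ∷ xs) ys = trans (length-++ (map (g x) ys)) (cong₂ _+_ (length-map (g x) ys) (length-product g xs ys))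

-- The first-moment argument; the factor `c` carries the denominator of the bound, so no division
-- occurs. If the head fails, removing it leaves the hypothesis true for the rest.
pigeonhole : ∀ (xs : List A) c y f → 1 ≤ length xs → length xs * y ≤ c * ∑ xs f →
  ∃ λ x → x ∈ xs × y ≤ c * f x
pigeonhole (x ∷ xs) c y f _ le with y ≤? c * f x
... | yes p = x , here refl , p
... | no  p with xs in eq
...   | [] = contradiction (begin
    y                ≡⟨ +-identityʳ y ⟨
    y + 0            ≤⟨ le ⟩
    c * (f x + 0)    ≡⟨ cong (c *_) (+-identityʳ (f x)) ⟩
    c * f x          ∎) p
  where open ≤-Reasoning
...   | z ∷ zs with pigeonhole (z ∷ zs) c y f (s≤s z≤n) (+-cancelˡ-≤ y _ _ (begin
    y + length (z ∷ zs) * y             ≤⟨ le ⟩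
    c * (f x + ∑ (z ∷ zs) f)            ≡⟨ *-distribˡ-+ c (f x) _ ⟩
    c * f x + c * ∑ (z ∷ zs) f          ≤⟨ +-monoˡ-≤ _ (<⇒≤ (≰⇒> p)) ⟩
    y + c * ∑ (z ∷ zs) f                ∎))
  where open ≤-Reasoning
...     | w , w∈ , q = w , there w∈ , q

-- Sums over initial segments of ℕ

∑-upTo-split : ∀ m n f → ∑ (upTo (m + n)) f ≡ ∑ (upTo m) f + ∑ (upTo n) (λ k → f (m + k))
∑-upTo-split m n f = trans (flat f (m + n)) (trans (go m f) (sym (cong₂ _+_ (flat f m) (flat _ n))))
  where
  flat : ∀ f n → ∑ (upTo n) f ≡ sum (applyUpTo f n)
  flat f n = cong sum (map-applyUpTo (λ x → x) f n)
  go : ∀ m f → sum (applyUpTo f (m + n)) ≡ sum (applyUpTo f m) + sum (applyUpTo (λ k → f (m + k)) n)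
  go zero    f = refl
  go (suc m) f = trans (cong (f 0 +_) (go m (f ∘ suc))) (sym (+-assoc (f 0) _ _))

∑-upTo-suc : ∀ n f → ∑ (upTo (suc n)) f ≡ ∑ (upTo n) f + f n
∑-upTo-suc n f = begin
  ∑ (upTo (suc n)) f               ≡⟨ cong (λ k → ∑ (upTo k) f) (+-comm 1 n) ⟩
  ∑ (upTo (n + 1)) f               ≡⟨ ∑-upTo-split n 1 f ⟩
  ∑ (upTo n) f + (f (n + 0) + 0)   ≡⟨ cong (∑ (upTo n) f +_) (trans (+-identityʳ _) (cong f (+-identityʳ n))) ⟩
  ∑ (upTo n) f + f n               ∎
  where open ≡-Reasoning

∑-upTo-* : ∀ m n f → ∑ (upTo (m * n)) f ≡ ∑ (upTo m) (λ u → ∑ (upTo n) (λ l → f (u * n + l)))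
∑-upTo-* zero    n f = refl
∑-upTo-* (suc m) n f = begin
  ∑ (upTo (n + m * n)) f                               ≡⟨ cong (λ k → ∑ (upTo k) f) (+-comm n (m * n)) ⟩
  ∑ (upTo (m * n + n)) f                               ≡⟨ ∑-upTo-split (m * n) n f ⟩
  ∑ (upTo (m * n)) f + ∑ (upTo n) (λ l → f (m * n + l)) ≡⟨ cong (_+ ∑ (upTo n) (λ l → f (m * n + l))) (∑-upTo-* m n f) ⟩
  _                                                     ≡⟨ ∑-upTo-suc m _ ⟨
  _                                                     ∎
  where open ≡-Reasoning

∑-upTo-head : ∀ n f → ∑ (upTo (suc n)) f ≡ f 0 + ∑ (upTo n) (f ∘ suc)
∑-upTo-head n f = trans (∑-upTo-split 1 n f) (cong (_+ ∑ (upTo n) (f ∘ suc)) (+-identityʳ (f 0)))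

∑-upTo-≤ : ∀ n a (p : ℕ → Bool) → (∀ k → p k ≡ true → k < a) → ∑ (upTo n) (𝟙 ∘ p) ≤ a
∑-upTo-≤ zero    a p below = z≤n
∑-upTo-≤ (suc n) a p below rewrite ∑-upTo-head n (𝟙 ∘ p) with a
... | suc a = +-mono-≤ (𝟙≤1 (p 0)) (∑-upTo-≤ n a (p ∘ suc) (λ k pk → s≤s⁻¹ (below (suc k) pk)))
... | zero  with p 0 in eq
...   | true  = contradiction (below 0 eq) λ ()
...   | false = ∑-upTo-≤ n 0 (p ∘ suc) (λ k pk → contradiction (below (suc k) pk) λ ())

-- The upper bounds on numbers of parameters and classes reduce to this, since it does not ask where
-- the interval begins. After shifting to the least solution, all solutions lie below `a`.
∑-upTo-diameter : ∀ n a (p : ℕ → Bool) → (∀ k k' → p k ≡ true → p k' ≡ true → k' < k + a) →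
  ∑ (upTo n) (𝟙 ∘ p) ≤ a
∑-upTo-diameter zero    a p diam = z≤n
∑-upTo-diameter (suc n) a p diam = go (p 0) refl
  where
  go : ∀ b → p 0 ≡ b → ∑ (upTo (suc n)) (𝟙 ∘ p) ≤ a
  go true  eq = ∑-upTo-≤ (suc n) a p (λ k → diam 0 k eq)
  go false eq = ≤-trans (≤-reflexive (trans (∑-upTo-head n (𝟙 ∘ p)) (cong (λ b → 𝟙 b + ∑ (upTo n) (𝟙 ∘ p ∘ suc)) eq)))
    (∑-upTo-diameter n a (p ∘ suc) (λ k k' pk pk' → s≤s⁻¹ (diam (suc k) (suc k') pk pk')))

∑-upTo-≥ : ∀ n lo a (p : ℕ → Bool) → lo + a ≤ n → (∀ b → b < a → p (lo + b) ≡ true) →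
  a ≤ ∑ (upTo n) (𝟙 ∘ p)
∑-upTo-≥ n lo a p le inside with m≤n⇒∃[o]m+o≡n le
... | r , refl = begin
    a                                                  ≡⟨ trans (*-identityʳ _) (length-applyUpTo _ a) ⟨
    length (upTo a) * 1                                ≡⟨ ∑-const (upTo a) 1 ⟨
    ∑ (upTo a) (λ _ → 1)                               ≤⟨ ∑-mono-∈ (upTo a) (λ b b∈ → ≤-reflexive (sym (cong 𝟙 (inside b (∈-upTo⁻ b∈))))) ⟩
    ∑ (upTo a) (λ b → 𝟙 (p (lo + b)))                  ≤⟨ m≤n+m _ _ ⟩
    ∑ (upTo lo) (𝟙 ∘ p) + ∑ (upTo a) (λ b → 𝟙 (p (lo + b))) ≡⟨ ∑-upTo-split lo a (𝟙 ∘ p) ⟨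
    ∑ (upTo (lo + a)) (𝟙 ∘ p)                          ≤⟨ m≤m+n _ _ ⟩
    ∑ (upTo (lo + a)) (𝟙 ∘ p) + ∑ (upTo r) (λ b → 𝟙 (p (lo + a + b))) ≡⟨ ∑-upTo-split (lo + a) r (𝟙 ∘ p) ⟨
    ∑ (upTo (lo + a + r)) (𝟙 ∘ p)                      ∎
  where open ≤-Reasoning

-- Sums over function spaces

-- The probability space: an independent uniform choice from `ps` at each of `n` vertices.
functions : List A → ∀ n → List (Fin n → A)
functions ps zero    = (λ ()) ∷ []
functions ps (suc n) = cartesianProductWith _◂_ ps (functions ps n)

length-functions : ∀ (ps : List A) n → 1 ≤ length ps → 1 ≤ length (functions ps n)
length-functions ps zero    _  = ≤-refl
length-functions ps (suc n) ne = subst (1 ≤_) (sym (length-product _◂_ ps (functions ps n)))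
  (*-mono-≤ ne (length-functions ps n ne))

∑-functions-suc : ∀ (ps : List A) n f →
  ∑ (functions ps (suc n)) f ≡ ∑ ps (λ r → ∑ (functions ps n) (λ ω → f (r ◂ ω)))
∑-functions-suc ps n f = ∑-product _◂_ ps (functions ps n) f

-- The choice at a single vertex is uniform; both denominators are cleared to stay in ℕ.
marginal : ∀ (ps : List A) n (x : Fin n) (g : A → ℕ) →
  length ps * ∑ (functions ps n) (λ ω → g (ω x)) ≡ length (functions ps n) * ∑ ps g
marginal ps (suc n) zero g = begin
  length ps * ∑ (functions ps (suc n)) (λ ω → g (ω zero))
    ≡⟨ cong (length ps *_) (∑-functions-suc ps n (λ ω → g (ω zero))) ⟩
  length ps * ∑ ps (λ r → ∑ (functions ps n) (λ _ → g r))
    ≡⟨ cong (length ps *_) (∑-cong ps (λ r → ∑-const (functions ps n) (g r))) ⟩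
  length ps * ∑ ps (λ r → length (functions ps n) * g r)
    ≡⟨ cong (length ps *_) (∑-*ˡ ps (length (functions ps n)) g) ⟩
  length ps * (length (functions ps n) * ∑ ps g)
    ≡⟨ *-assoc (length ps) _ _ ⟨
  length ps * length (functions ps n) * ∑ ps g
    ≡⟨ cong (_* ∑ ps g) (length-product _◂_ ps (functions ps n)) ⟨
  length (functions ps (suc n)) * ∑ ps g
    ∎
  where open ≡-Reasoning
marginal ps (suc n) (suc x) g = begin
  length ps * ∑ (functions ps (suc n)) (λ ω → g (ω (suc x)))
    ≡⟨ cong (length ps *_) (∑-functions-suc ps n (λ ω → g (ω (suc x)))) ⟩
  length ps * ∑ ps (λ _ → ∑ (functions ps n) (λ ω → g (ω x)))
    ≡⟨ cong (length ps *_) (∑-const ps _) ⟩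
  length ps * (length ps * ∑ (functions ps n) (λ ω → g (ω x)))
    ≡⟨ cong (length ps *_) (marginal ps n x g) ⟩
  length ps * (length (functions ps n) * ∑ ps g)
    ≡⟨ *-assoc (length ps) _ _ ⟨
  length ps * length (functions ps n) * ∑ ps g
    ≡⟨ cong (_* ∑ ps g) (length-product _◂_ ps (functions ps n)) ⟨
  length (functions ps (suc n)) * ∑ ps g
    ∎
  where open ≡-Reasoning

-- Only the second factor is averaged out. The first remains a sum over all choices, because it
-- recurs as the number of retained cases in the conflict bound.
independence : ∀ (ps : List A) n (x x' : Fin n) (f g : A → ℕ) → x ≢ x' →
  length ps * ∑ (functions ps n) (λ ω → f (ω x) * g (ω x')) ≡ ∑ (functions ps n) (λ ω → f (ω x)) * ∑ ps g
independence ps (suc n) zero zero f g ne = contradiction refl ne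
independence ps (suc n) zero (suc x') f g _ = begin
  length ps * ∑ (functions ps (suc n)) (λ ω → f (ω zero) * g (ω (suc x')))
    ≡⟨ cong (length ps *_) (∑-functions-suc ps n (λ ω → f (ω zero) * g (ω (suc x')))) ⟩
  length ps * ∑ ps (λ r → ∑ (functions ps n) (λ ω → f r * g (ω x')))
    ≡⟨ cong (length ps *_) (∑-cong ps (λ r → ∑-*ˡ (functions ps n) (f r) _)) ⟩
  length ps * ∑ ps (λ r → f r * ∑ (functions ps n) (λ ω → g (ω x')))
    ≡⟨ cong (length ps *_) (∑-*ʳ ps _ f) ⟩
  length ps * (∑ ps f * ∑ (functions ps n) (λ ω → g (ω x')))
    ≡⟨ swapˡ (length ps) (∑ ps f) _ ⟩
  ∑ ps f * (length ps * ∑ (functions ps n) (λ ω → g (ω x')))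
    ≡⟨ cong (∑ ps f *_) (marginal ps n x' g) ⟩
  ∑ ps f * (length (functions ps n) * ∑ ps g)
    ≡⟨ regroup (∑ ps f) (length (functions ps n)) (∑ ps g) ⟩
  length (functions ps n) * ∑ ps f * ∑ ps g
    ≡⟨ cong (_* ∑ ps g) (∑-*ˡ ps (length (functions ps n)) f) ⟨
  ∑ ps (λ r → length (functions ps n) * f r) * ∑ ps g
    ≡⟨ cong (_* ∑ ps g) (∑-cong ps (λ r → ∑-const (functions ps n) (f r))) ⟨
  ∑ ps (λ r → ∑ (functions ps n) (λ _ → f r)) * ∑ ps g
    ≡⟨ cong (_* ∑ ps g) (∑-functions-suc ps n (λ ω → f (ω zero))) ⟨
  ∑ (functions ps (suc n)) (λ ω → f (ω zero)) * ∑ ps g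
    ∎
  where
  open ≡-Reasoning
  swapˡ : ∀ a b c → a * (b * c) ≡ b * (a * c)
  swapˡ = solve-∀
  regroup : ∀ a b c → a * (b * c) ≡ b * a * c
  regroup = solve-∀
independence ps (suc n) (suc x) zero f g _ = begin
  length ps * ∑ (functions ps (suc n)) (λ ω → f (ω (suc x)) * g (ω zero))
    ≡⟨ cong (length ps *_) (∑-functions-suc ps n (λ ω → f (ω (suc x)) * g (ω zero))) ⟩
  length ps * ∑ ps (λ r → ∑ (functions ps n) (λ ω → f (ω x) * g r))
    ≡⟨ cong (length ps *_) (∑-cong ps (λ r → ∑-*ʳ (functions ps n) (g r) _)) ⟩
  length ps * ∑ ps (λ r → ∑ (functions ps n) (λ ω → f (ω x)) * g r)
    ≡⟨ cong (length ps *_) (∑-*ˡ ps (∑ (functions ps n) (λ ω → f (ω x))) g) ⟩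
  length ps * (∑ (functions ps n) (λ ω → f (ω x)) * ∑ ps g)
    ≡⟨ *-assoc (length ps) _ _ ⟨
  length ps * ∑ (functions ps n) (λ ω → f (ω x)) * ∑ ps g
    ≡⟨ cong (_* ∑ ps g) (∑-const ps _) ⟨
  ∑ ps (λ _ → ∑ (functions ps n) (λ ω → f (ω x))) * ∑ ps g
    ≡⟨ cong (_* ∑ ps g) (∑-functions-suc ps n (λ ω → f (ω (suc x)))) ⟨
  ∑ (functions ps (suc n)) (λ ω → f (ω (suc x))) * ∑ ps g
    ∎
  where open ≡-Reasoning
independence ps (suc n) (suc x) (suc x') f g ne = begin
  length ps * ∑ (functions ps (suc n)) (λ ω → f (ω (suc x)) * g (ω (suc x')))
    ≡⟨ cong (length ps *_) (∑-functions-suc ps n (λ ω → f (ω (suc x)) * g (ω (suc x')))) ⟩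
  length ps * ∑ ps (λ _ → ∑ (functions ps n) (λ ω → f (ω x) * g (ω x')))
    ≡⟨ cong (length ps *_) (∑-const ps _) ⟩
  length ps * (length ps * ∑ (functions ps n) (λ ω → f (ω x) * g (ω x')))
    ≡⟨ cong (length ps *_) (independence ps n x x' f g (ne ∘ cong suc)) ⟩
  length ps * (∑ (functions ps n) (λ ω → f (ω x)) * ∑ ps g)
    ≡⟨ *-assoc (length ps) _ _ ⟨
  length ps * ∑ (functions ps n) (λ ω → f (ω x)) * ∑ ps g
    ≡⟨ cong (_* ∑ ps g) (∑-const ps _) ⟨
  ∑ ps (λ _ → ∑ (functions ps n) (λ ω → f (ω x))) * ∑ ps g
    ≡⟨ cong (_* ∑ ps g) (∑-functions-suc ps n (λ ω → f (ω (suc x)))) ⟨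
  ∑ (functions ps (suc n)) (λ ω → f (ω (suc x))) * ∑ ps g
    ∎
  where open ≡-Reasoning

-- Random selection of classes

other : ∀ {n} → Fin n → Fin n → ℕ
other z z' = 𝟙 (not (does (z Fin.≟ z')))

-- Here `a` and `b` weigh the event that the ends of `xy` hit a fixed class, while `e y'` and `f y'`
-- do so for a rival edge `xy'`. A choice at `x` admits at most `K` rivals, and each far end then
-- agrees with probability at most `k / length qs`.
module _ {P Q : Set} (ps : List P) (qs : List Q) {n m : ℕ} (x : Fin n) (y : Fin m)
  (a : P → ℕ) (b : Q → ℕ) (e : Fin m → P → ℕ) (f : Fin m → Q → ℕ) (K k : ℕ)
  (e≤K : ∀ p → ∑ (allFin m) (λ y' → e y' p) ≤ K) (f≤k : ∀ y' → ∑ qs (f y') ≤ k) where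

  private
    b-total = ∑ (functions qs m) (λ ω' → b (ω' y))

    -- With `p` fixed, linearity of expectation sums over the rivals. For `y' ≢ y` the choices at
    -- `y` and `y'` are independent, and `other` removes the case `y' ≡ y`.
    conflicts-at : ∀ p → length qs * ∑ (functions qs m) (λ ω' → a p * b (ω' y) * ∑ (allFin m) (λ y' → other y' y * (e y' p * f y' (ω' y'))))
      ≤ K * k * ∑ (functions qs m) (λ ω' → a p * b (ω' y))
    conflicts-at p = begin
      length qs * ∑ (functions qs m) (λ ω' → a p * b (ω' y) * ∑ (allFin m) (λ y' → other y' y * (e y' p * f y' (ω' y'))))
        ≡⟨ cong (length qs *_) (∑-cong (functions qs m) λ ω' → sym (∑-*ˡ (allFin m) (a p * b (ω' y)) _)) ⟩
      length qs * ∑ (functions qs m) (λ ω' → ∑ (allFin m) (λ y' → a p * b (ω' y) * (other y' y * (e y' p * f y' (ω' y')))))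
        ≡⟨ cong (length qs *_) (∑-swap (functions qs m) (allFin m) _) ⟩
      length qs * ∑ (allFin m) (λ y' → ∑ (functions qs m) (λ ω' → a p * b (ω' y) * (other y' y * (e y' p * f y' (ω' y')))))
        ≡⟨ cong (length qs *_) (∑-cong (allFin m) λ y' → trans
             (∑-cong (functions qs m) (λ ω' → regroup (a p) (b (ω' y)) (other y' y) (e y' p) (f y' (ω' y'))))
             (∑-*ˡ (functions qs m) (other y' y * (e y' p * a p)) (λ ω' → b (ω' y) * f y' (ω' y')))) ⟩
      length qs * ∑ (allFin m) (λ y' → other y' y * (e y' p * a p) * pair y')
        ≡⟨ ∑-*ˡ (allFin m) (length qs) _ ⟨
      ∑ (allFin m) (λ y' → length qs * (other y' y * (e y' p * a p) * pair y'))
        ≤⟨ ∑-mono (allFin m) term ⟩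
      ∑ (allFin m) (λ y' → e y' p * (a p * b-total * k))
        ≡⟨ ∑-*ʳ (allFin m) (a p * b-total * k) _ ⟩
      ∑ (allFin m) (λ y' → e y' p) * (a p * b-total * k)
        ≤⟨ *-monoˡ-≤ _ (e≤K p) ⟩
      K * (a p * b-total * k)
        ≡⟨ shuffle K (a p) b-total k ⟩
      K * k * (a p * b-total)
        ≡⟨ cong (K * k *_) (∑-*ˡ (functions qs m) (a p) _) ⟨
      K * k * ∑ (functions qs m) (λ ω' → a p * b (ω' y))
        ∎
      where
      open ≤-Reasoning
      pair : Fin m → ℕ
      pair y' = ∑ (functions qs m) (λ ω' → b (ω' y) * f y' (ω' y'))
      regroup : ∀ a b o e f → a * b * (o * (e * f)) ≡ o * (e * a) * (b * f)
      regroup = solve-∀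
      shuffle : ∀ K a b k → K * (a * b * k) ≡ K * k * (a * b)
      shuffle = solve-∀
      pull : ∀ l e a s → l * ((e * a + 0) * s) ≡ e * (a * (l * s))
      pull = solve-∀
      term : ∀ y' → length qs * (other y' y * (e y' p * a p) * pair y') ≤ e y' p * (a p * b-total * k)
      term y' with y' Fin.≟ y
      ... | yes _    = ≤-trans (≤-reflexive (*-zeroʳ (length qs))) z≤n
      ... | no y'≢y = begin
        length qs * ((e y' p * a p + 0) * pair y')   ≡⟨ pull (length qs) (e y' p) (a p) (pair y') ⟩
        e y' p * (a p * (length qs * pair y'))       ≡⟨ cong (λ s → e y' p * (a p * s)) (independence qs m y y' b (f y') (y'≢y ∘ sym)) ⟩
        e y' p * (a p * (b-total * ∑ qs (f y')))     ≤⟨ *-monoʳ-≤ (e y' p) (*-monoʳ-≤ (a p) (*-monoʳ-≤ b-total (f≤k y'))) ⟩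
        e y' p * (a p * (b-total * k))               ≡⟨ cong (e y' p *_) (*-assoc (a p) b-total k) ⟨
        e y' p * (a p * b-total * k)                 ∎

  conflicts-≤ : length qs * ∑ (functions ps n) (λ ω → ∑ (functions qs m) (λ ω' →
                  a (ω x) * b (ω' y) * ∑ (allFin m) (λ y' → other y' y * (e y' (ω x) * f y' (ω' y')))))
              ≤ K * k * ∑ (functions ps n) (λ ω → ∑ (functions qs m) (λ ω' → a (ω x) * b (ω' y)))
  conflicts-≤ = begin
    _ ≡⟨ ∑-*ˡ (functions ps n) (length qs) _ ⟨
    _ ≤⟨ ∑-mono (functions ps n) (λ ω → conflicts-at (ω x)) ⟩
    _ ≡⟨ ∑-*ˡ (functions ps n) (K * k) (λ ω → ∑ (functions qs m) (λ ω' → a (ω x) * b (ω' y))) ⟩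
    _ ∎
    where open ≤-Reasoning

-- `hitᴬ x y i p` means that under the choice `p` the vertex `x` puts `xy` into class `i`; `hitᴮ` is
-- the same for `y`.
module Thinning {P Q : Set} (ps : List P) (qs : List Q) {na nb : ℕ} (E : EdgeSet na nb) (h : ℕ)
  (hitᴬ : Fin na → Fin nb → ℕ → P → Bool) (hitᴮ : Fin na → Fin nb → ℕ → Q → Bool) where

  module _ (ω : Fin na → P) (ω' : Fin nb → Q) where

    retained : Fin na → Fin nb → ℕ → ℕ
    retained x y i = 𝟙 (E x y) * 𝟙 (hitᴬ x y i (ω x)) * 𝟙 (hitᴮ x y i (ω' y))

    conflictsᴬ : Fin na → Fin nb → ℕ → ℕ
    conflictsᴬ x y i = ∑ (allFin nb) (λ y' → other y' y * retained x y' i)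

    conflictsᴮ : Fin na → Fin nb → ℕ → ℕ
    conflictsᴮ x y i = ∑ (allFin na) (λ x' → other x' x * retained x' y i)

    survives : Fin na → Fin nb → ℕ → Bool
    survives x y i = E x y ∧ hitᴬ x y i (ω x) ∧ hitᴮ x y i (ω' y) ∧
      does (conflictsᴬ x y i + conflictsᴮ x y i ≟ 0)

    -- The alteration bound: a retained edge that does not survive has a conflict, which pays for
    -- it.
    retained-≤ : ∀ x y i → retained x y i ≤
      𝟙 (survives x y i) + (retained x y i * conflictsᴬ x y i + retained x y i * conflictsᴮ x y i)
    retained-≤ x y i with E x y | hitᴬ x y i (ω x) | hitᴮ x y i (ω' y)
    ... | false | _     | _     = z≤n
    ... | true  | false | _     = z≤n
    ... | true  | true  | false = z≤n
    ... | true  | true  | true  with conflictsᴬ x y i + conflictsᴮ x y i in eq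
    ...   | zero  = s≤s z≤n
    ...   | suc c = subst (1 ≤_) (sym (trans (cong₂ _+_ (*-identityˡ (conflictsᴬ x y i)) (*-identityˡ (conflictsᴮ x y i))) eq)) (s≤s z≤n)

  -- `k` bounds the choices that hit a given edge, `K` the edges at a vertex hit by a given choice.
  -- Sparseness bounds the expected number of rivals of a retained edge by 1/8 at its end in A and
  -- by 1/4 at its end in B.
  module _ (kᴬ Kᴬ kᴮ Kᴮ : ℕ → ℕ) .{{_ : NonZero (length ps)}} .{{_ : NonZero (length qs)}}
    (paramsᴬ : ∀ x y i → ∑ ps (𝟙 ∘ hitᴬ x y i) ≤ kᴬ i)
    (paramsᴮ : ∀ x y i → ∑ qs (𝟙 ∘ hitᴮ x y i) ≤ kᴮ i)
    (degreeᴬ : ∀ x i p → ∑ (allFin nb) (λ y → 𝟙 (E x y) * 𝟙 (hitᴬ x y i p)) ≤ Kᴬ i)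
    (degreeᴮ : ∀ y i q → ∑ (allFin na) (λ x → 𝟙 (E x y) * 𝟙 (hitᴮ x y i q)) ≤ Kᴮ i)
    (sparseᴬ : ∀ i → i < h → 8 * (Kᴬ i * kᴮ i) ≤ length qs)
    (sparseᴮ : ∀ i → i < h → 4 * (Kᴮ i * kᴬ i) ≤ length ps) where

    private
      Ω  = functions ps na
      Ω' = functions qs nb

      -- Not normalised: the expectation times the number of choices.
      𝔼 : ((Fin na → P) → (Fin nb → Q) → ℕ) → ℕ
      𝔼 F = ∑ Ω (λ ω → ∑ Ω' (F ω))

      Ret : Fin na → Fin nb → ℕ → ℕ
      Ret x y i = 𝔼 (λ ω ω' → retained ω ω' x y i)

      scale : ∀ l .{{_ : NonZero l}} c K C R → l * C ≤ K * R → c * K ≤ l → c * C ≤ R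
      scale l c K C R le cK≤l = *-cancelˡ-≤ l (begin
        l * (c * C)   ≡⟨ flip-* l c C ⟩
        c * (l * C)   ≤⟨ *-monoʳ-≤ c le ⟩
        c * (K * R)   ≡⟨ *-assoc c K R ⟨
        c * K * R     ≤⟨ *-monoˡ-≤ R cK≤l ⟩
        l * R         ∎)
        where
        open ≤-Reasoning
        flip-* : ∀ a b c → a * (b * c) ≡ b * (a * c)
        flip-* = solve-∀

      conflictsᴬ-≤ : ∀ x y i → i < h → 8 * 𝔼 (λ ω ω' → retained ω ω' x y i * conflictsᴬ ω ω' x y i) ≤ Ret x y i
      conflictsᴬ-≤ x y i i<h = scale (length qs) 8 (Kᴬ i * kᴮ i) _ _
        (conflicts-≤ ps qs x y (λ p → 𝟙 (E x y) * 𝟙 (hitᴬ x y i p)) (𝟙 ∘ hitᴮ x y i)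
          (λ y' p → 𝟙 (E x y') * 𝟙 (hitᴬ x y' i p)) (λ y' → 𝟙 ∘ hitᴮ x y' i) (Kᴬ i) (kᴮ i)
          (degreeᴬ x i) (λ y' → paramsᴮ x y' i))
        (sparseᴬ i i<h)

      -- The general bound applied with the two sides exchanged; the outer equalities only reorder
      -- sums and factors.
      conflictsᴮ-≤ : ∀ x y i → i < h → 4 * 𝔼 (λ ω ω' → retained ω ω' x y i * conflictsᴮ ω ω' x y i) ≤ Ret x y i
      conflictsᴮ-≤ x y i i<h = scale (length ps) 4 (Kᴮ i * kᴬ i) _ _ (begin
          length ps * 𝔼 (λ ω ω' → retained ω ω' x y i * conflictsᴮ ω ω' x y i)
            ≡⟨ cong (length ps *_) (trans (∑-swap Ω Ω' (λ ω ω' → retained ω ω' x y i * conflictsᴮ ω ω' x y i))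
                 (∑-cong Ω' λ ω' → ∑-cong Ω λ ω → cong₂ _*_ (exch (𝟙 (E x y)) _ _)
                   (∑-cong (allFin na) λ x' → cong (other x' x *_) (exch (𝟙 (E x' y)) _ _)))) ⟩
          _ ≤⟨ conflicts-≤ qs ps y x (λ q → 𝟙 (E x y) * 𝟙 (hitᴮ x y i q)) (𝟙 ∘ hitᴬ x y i)
                 (λ x' q → 𝟙 (E x' y) * 𝟙 (hitᴮ x' y i q)) (λ x' → 𝟙 ∘ hitᴬ x' y i) (Kᴮ i) (kᴬ i)
                 (degreeᴮ y i) (λ x' → paramsᴬ x' y i) ⟩
          _ ≡⟨ cong (Kᴮ i * kᴬ i *_) (trans (∑-cong Ω' λ ω' → ∑-cong Ω λ ω → exch (𝟙 (E x y)) _ _)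
                 (sym (∑-swap Ω Ω' (λ ω ω' → retained ω ω' x y i)))) ⟩
          Kᴮ i * kᴬ i * Ret x y i ∎)
        (sparseᴮ i i<h)
        where
        open ≤-Reasoning
        exch : ∀ a b c → a * b * c ≡ a * c * b
        exch = solve-∀

      Surv : Fin na → Fin nb → ℕ → ℕ
      Surv x y i = 𝔼 (λ ω ω' → 𝟙 (survives ω ω' x y i))

      𝔼-+ : ∀ F G → 𝔼 (λ ω ω' → F ω ω' + G ω ω') ≡ 𝔼 F + 𝔼 G
      𝔼-+ F G = trans (∑-cong Ω (λ ω → ∑-+ Ω' (F ω) (G ω))) (∑-+ Ω _ _)

      -- Rivals at A cost 1/8 of the retained cases and rivals at B cost 1/4, which leaves 5/8.
      Ret-≤-Surv : ∀ x y i → i < h → 5 * Ret x y i ≤ 8 * Surv x y i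
      Ret-≤-Surv x y i i<h = +-cancelʳ-≤ (3 * R) _ _ (begin
        5 * R + 3 * R           ≡⟨ *-distribʳ-+ R 5 3 ⟨
        8 * R                   ≤⟨ *-monoʳ-≤ 8 (∑-mono Ω λ ω → ∑-mono Ω' λ ω' → retained-≤ ω ω' x y i) ⟩
        8 * 𝔼 (λ ω ω' → 𝟙 (survives ω ω' x y i) + (retained ω ω' x y i * conflictsᴬ ω ω' x y i + retained ω ω' x y i * conflictsᴮ ω ω' x y i))
                                ≡⟨ cong (8 *_) (trans (𝔼-+ (λ ω ω' → 𝟙 (survives ω ω' x y i)) _) (cong (Surv x y i +_) (𝔼-+ _ _))) ⟩
        8 * (Surv x y i + (CA + CB)) ≡⟨ expand (Surv x y i) CA CB ⟩
        8 * Surv x y i + (8 * CA + 2 * (4 * CB)) ≤⟨ +-monoʳ-≤ (8 * Surv x y i) (+-mono-≤ (conflictsᴬ-≤ x y i i<h) (*-monoʳ-≤ 2 (conflictsᴮ-≤ x y i i<h))) ⟩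
        8 * Surv x y i + (R + 2 * R) ∎)
        where
        open ≤-Reasoning
        R  = Ret x y i
        CA = 𝔼 (λ ω ω' → retained ω ω' x y i * conflictsᴬ ω ω' x y i)
        CB = 𝔼 (λ ω ω' → retained ω ω' x y i * conflictsᴮ ω ω' x y i)
        expand : ∀ s a b → 8 * (s + (a + b)) ≡ 8 * s + (8 * a + 2 * (4 * b))
        expand = solve-∀

      expected : Fin na → Fin nb → ℕ → ℕ
      expected x y i = 𝟙 (E x y) * ∑ ps (𝟙 ∘ hitᴬ x y i) * ∑ qs (𝟙 ∘ hitᴮ x y i)

      Ret-≡ : ∀ x y i → length ps * length qs * Ret x y i ≡ length Ω * length Ω' * expected x y i
      Ret-≡ x y i = begin
        length ps * length qs * Ret x y i
          ≡⟨ cong (length ps * length qs *_) (trans (∑-cong Ω λ ω → ∑-*ˡ Ω' (𝟙 (E x y) * 𝟙 (hitᴬ x y i (ω x))) (λ ω' → 𝟙 (hitᴮ x y i (ω' y))))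
               (trans (∑-*ʳ Ω sB _) (cong (_* sB) (∑-*ˡ Ω (𝟙 (E x y)) (λ ω → 𝟙 (hitᴬ x y i (ω x))))))) ⟩
        length ps * length qs * (𝟙 (E x y) * sA * sB)
          ≡⟨ arrange (length ps) (length qs) (𝟙 (E x y)) sA sB ⟩
        𝟙 (E x y) * (length ps * sA) * (length qs * sB)
          ≡⟨ cong₂ (λ s s' → 𝟙 (E x y) * s * s') (marginal ps na x (𝟙 ∘ hitᴬ x y i)) (marginal qs nb y (𝟙 ∘ hitᴮ x y i)) ⟩
        𝟙 (E x y) * (length Ω * ∑ ps (𝟙 ∘ hitᴬ x y i)) * (length Ω' * ∑ qs (𝟙 ∘ hitᴮ x y i))
          ≡⟨ arrange (length Ω) (length Ω') (𝟙 (E x y)) _ _ ⟨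
        length Ω * length Ω' * expected x y i ∎
        where
        open ≡-Reasoning
        sA = ∑ Ω (λ ω → 𝟙 (hitᴬ x y i (ω x)))
        sB = ∑ Ω' (λ ω' → 𝟙 (hitᴮ x y i (ω' y)))
        arrange : ∀ p q e a b → p * q * (e * a * b) ≡ e * (p * a) * (q * b)
        arrange = solve-∀

      total : (Fin na → Fin nb → ℕ → ℕ) → ℕ
      total F = ∑ (allFin na) λ x → ∑ (allFin nb) λ y → ∑ (upTo h) (F x y)

      total-*ˡ : ∀ c F → total (λ x y i → c * F x y i) ≡ c * total F
      total-*ˡ c F = trans (∑-cong (allFin na) λ x → trans (∑-cong (allFin nb) λ y → ∑-*ˡ (upTo h) c (F x y))
        (∑-*ˡ (allFin nb) c _)) (∑-*ˡ (allFin na) c _)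

      total-mono : ∀ F G → (∀ x y i → i < h → F x y i ≤ G x y i) → total F ≤ total G
      total-mono F G le = ∑-mono (allFin na) λ x → ∑-mono (allFin nb) λ y → ∑-mono-∈ (upTo h) λ i i∈ → le x y i (∈-upTo⁻ i∈)

      𝔼-∑ : ∀ {X : Set} (xs : List X) (F : X → (Fin na → P) → (Fin nb → Q) → ℕ) →
        𝔼 (λ ω ω' → ∑ xs (λ x → F x ω ω')) ≡ ∑ xs (λ x → 𝔼 (F x))
      𝔼-∑ xs F = trans (∑-cong Ω λ ω → ∑-swap Ω' xs (λ ω' x → F x ω ω')) (∑-swap Ω xs _)

      𝔼-total : ∀ (F : Fin na → Fin nb → ℕ → (Fin na → P) → (Fin nb → Q) → ℕ) →
        𝔼 (λ ω ω' → total (λ x y i → F x y i ω ω')) ≡ total (λ x y i → 𝔼 (F x y i))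
      𝔼-total F = trans (𝔼-∑ (allFin na) _) (∑-cong (allFin na) λ x →
        trans (𝔼-∑ (allFin nb) _) (∑-cong (allFin nb) λ y → 𝔼-∑ (upTo h) (F x y)))

      average : length Ω * (length Ω' * (5 * total expected)) ≤
        8 * (length ps * length qs) * 𝔼 (λ ω ω' → total (λ x y i → 𝟙 (survives ω ω' x y i)))
      average = begin
        length Ω * (length Ω' * (5 * total expected))
          ≡⟨ arrange (length Ω) (length Ω') (total expected) ⟩
        5 * (length Ω * length Ω' * total expected)
          ≡⟨ cong (5 *_) (total-*ˡ (length Ω * length Ω') expected) ⟨
        5 * total (λ x y i → length Ω * length Ω' * expected x y i)
          ≤⟨ *-monoʳ-≤ 5 (total-mono _ _ λ x y i _ → ≤-reflexive (sym (Ret-≡ x y i))) ⟩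
        5 * total (λ x y i → length ps * length qs * Ret x y i)
          ≡⟨ cong (5 *_) (total-*ˡ (length ps * length qs) Ret) ⟩
        5 * (length ps * length qs * total Ret)
          ≡⟨ flip-* 5 (length ps * length qs) (total Ret) ⟩
        length ps * length qs * (5 * total Ret)
          ≡⟨ cong (length ps * length qs *_) (total-*ˡ 5 Ret) ⟨
        length ps * length qs * total (λ x y i → 5 * Ret x y i)
          ≤⟨ *-monoʳ-≤ (length ps * length qs) (total-mono _ _ Ret-≤-Surv) ⟩
        length ps * length qs * total (λ x y i → 8 * Surv x y i)
          ≡⟨ cong (length ps * length qs *_) (total-*ˡ 8 Surv) ⟩
        length ps * length qs * (8 * total Surv)
          ≡⟨ flip-*-assoc (length ps * length qs) 8 (total Surv) ⟩
        8 * (length ps * length qs) * total Surv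
          ≡⟨ cong (8 * (length ps * length qs) *_) (𝔼-total (λ x y i ω ω' → 𝟙 (survives ω ω' x y i))) ⟨
        8 * (length ps * length qs) * 𝔼 (λ ω ω' → total (λ x y i → 𝟙 (survives ω ω' x y i))) ∎
        where
        open ≤-Reasoning
        arrange : ∀ a b t → a * (b * (5 * t)) ≡ 5 * (a * b * t)
        arrange = solve-∀
        flip-* : ∀ a b t → a * (b * t) ≡ b * (a * t)
        flip-* = solve-∀
        flip-*-assoc : ∀ a b t → a * (b * t) ≡ b * a * t
        flip-*-assoc = solve-∀

    -- The choices are fixed one side at a time: first an `ω` whose mean over all `ω'` is large
    -- enough, then a good `ω'` for it.
    exists-thinning : ∃₂ λ ω ω' → 5 * (∑ (allFin na) λ x → ∑ (allFin nb) λ y → ∑ (upTo h) (λ i →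
          𝟙 (E x y) * ∑ ps (𝟙 ∘ hitᴬ x y i) * ∑ qs (𝟙 ∘ hitᴮ x y i)))
        ≤ 8 * (length ps * length qs) * (∑ (allFin na) λ x → ∑ (allFin nb) λ y → ∑ (upTo h) (λ i → 𝟙 (survives ω ω' x y i)))
    exists-thinning = proj₁ choiceᴬ , proj₁ choiceᴮ , proj₂ (proj₂ choiceᴮ)
      where
      c = 8 * (length ps * length qs)
      survivors : (Fin na → P) → (Fin nb → Q) → ℕ
      survivors ω ω' = total (λ x y i → 𝟙 (survives ω ω' x y i))
      choiceᴬ = pigeonhole Ω c (length Ω' * (5 * total expected)) (λ ω → ∑ Ω' (survivors ω))
        (length-functions ps na (>-nonZero⁻¹ (length ps))) average
      choiceᴮ = pigeonhole Ω' c (5 * total expected) (survivors (proj₁ choiceᴬ))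
        (length-functions qs nb (>-nonZero⁻¹ (length qs))) (proj₂ (proj₂ choiceᴬ))

-- Counting the edges at a vertex through their colours

∑-allFin-suc : ∀ n f → ∑ (allFin (suc n)) f ≡ f zero + ∑ (allFin n) (f ∘ suc)
∑-allFin-suc n f = cong (λ xs → f zero + sum xs) (trans (map-tabulate suc f) (sym (map-tabulate id (f ∘ suc))))

∑-allFin-unique : ∀ n (p : Fin n → Bool) → (∀ z z' → p z ≡ true → p z' ≡ true → z ≡ z') → ∑ (allFin n) (𝟙 ∘ p) ≤ 1
∑-allFin-unique zero    p uniq = z≤n
∑-allFin-unique (suc n) p uniq = ≤-trans (≤-reflexive (∑-allFin-suc n (𝟙 ∘ p))) (go (p zero) refl)
  where
  open ≤-Reasoning
  go : ∀ b → p zero ≡ b → 𝟙 (p zero) + ∑ (allFin n) (𝟙 ∘ p ∘ suc) ≤ 1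
  go false eq = ≤-trans (≤-reflexive (cong (λ b → 𝟙 b + ∑ (allFin n) (𝟙 ∘ p ∘ suc)) eq))
    (∑-allFin-unique n (p ∘ suc) (λ z z' pz pz' → Fin.suc-injective (uniq (suc z) (suc z') pz pz')))
  go true eq = begin
    𝟙 (p zero) + ∑ (allFin n) (𝟙 ∘ p ∘ suc)  ≤⟨ +-mono-≤ (𝟙≤1 (p zero)) (∑-mono (allFin n) (λ z → vanish z (p (suc z)) refl)) ⟩
    1 + ∑ (allFin n) (λ _ → 0)               ≡⟨ cong suc (trans (∑-const (allFin n) 0) (*-zeroʳ (length (allFin n)))) ⟩
    1                                        ∎
    where
    vanish : ∀ z b → p (suc z) ≡ b → 𝟙 (p (suc z)) ≤ 0
    vanish z true  eq' = contradiction (uniq zero (suc z) eq eq') λ ()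
    vanish z false eq' = ≤-reflexive (cong 𝟙 eq')

from-does : ∀ {P : Set} (P? : Dec P) → does P? ≡ true → P
from-does (yes p) _ = p

∧-true : ∀ {a b} → a ∧ b ≡ true → a ≡ true × b ≡ true
∧-true {true} {true} _ = refl , refl

-- At a vertex of a properly coloured graph each colour occurs at most once. A sum over edges thus
-- becomes a sum over colours, where digits can be counted.
∑-injective : ∀ n N (e : Fin n → Bool) (c : Fin n → ℕ) (f : ℕ → ℕ) → (∀ z → e z ≡ true → c z < N) →
  (∀ z z' → e z ≡ true → e z' ≡ true → c z ≡ c z' → z ≡ z') →
  ∑ (allFin n) (λ z → 𝟙 (e z) * f (c z)) ≤ ∑ (upTo N) f
∑-injective n N e c f bound inj = begin
  ∑ (allFin n) (λ z → 𝟙 (e z) * f (c z))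
    ≤⟨ ∑-mono (allFin n) (λ z → locate z (e z) refl) ⟩
  ∑ (allFin n) (λ z → ∑ (upTo N) (λ v → 𝟙 (e z ∧ does (c z ≟ v)) * f v))
    ≡⟨ ∑-swap (allFin n) (upTo N) _ ⟩
  ∑ (upTo N) (λ v → ∑ (allFin n) (λ z → 𝟙 (e z ∧ does (c z ≟ v)) * f v))
    ≡⟨ ∑-cong (upTo N) (λ v → ∑-*ʳ (allFin n) (f v) _) ⟩
  ∑ (upTo N) (λ v → ∑ (allFin n) (λ z → 𝟙 (e z ∧ does (c z ≟ v))) * f v)
    ≤⟨ ∑-mono (upTo N) (λ v → *-monoˡ-≤ (f v) (∑-allFin-unique n (λ z → e z ∧ does (c z ≟ v)) (unique v))) ⟩
  ∑ (upTo N) (λ v → 1 * f v)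
    ≡⟨ ∑-cong (upTo N) (λ v → *-identityˡ (f v)) ⟩
  ∑ (upTo N) f ∎
  where
  open ≤-Reasoning
  locate : ∀ z b → e z ≡ b → 𝟙 (e z) * f (c z) ≤ ∑ (upTo N) (λ v → 𝟙 (e z ∧ does (c z ≟ v)) * f v)
  locate z false eq = ≤-trans (≤-reflexive (cong (λ b → 𝟙 b * f (c z)) eq)) z≤n
  locate z true  eq = ≤-trans
    (≤-reflexive (cong (λ b → 𝟙 b * f (c z)) (trans eq (sym (cong₂ _∧_ eq (dec-true (c z ≟ c z) refl))))))
    (∑-member (λ v → 𝟙 (e z ∧ does (c z ≟ v)) * f v) (∈-upTo⁺ (bound z eq)))
  unique : ∀ v z z' → e z ∧ does (c z ≟ v) ≡ true → e z' ∧ does (c z' ≟ v) ≡ true → z ≡ z'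
  unique v z z' p p' = inj z z' (proj₁ (∧-true p)) (proj₁ (∧-true p'))
    (trans (from-does (c z ≟ v) (proj₂ (∧-true p))) (sym (from-does (c z' ≟ v) (proj₂ (∧-true p')))))

-- Binary digits

infixl 8 _≫_

_≫_ : ℕ → ℕ → ℕ
m ≫ i = (m / 2 ^ i) {{m^n≢0 2 i}}

isEven : ℕ → Bool
isEven zero    = true
isEven (suc n) = not (isEven n)

isEven⇒double : ∀ n → isEven n ≡ true → ∃ λ a → n ≡ a * 2
isEven⇒double zero          _  = 0 , refl
isEven⇒double (suc zero)    ()
isEven⇒double (suc (suc n)) ev with isEven n in eq
... | true with isEven⇒double n eq
...   | a , refl = suc a , refl

block-/ : ∀ v k b → b < k → .{{_ : NonZero k}} → (v * k + b) / k ≡ v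
block-/ v k b b<k = begin
  (v * k + b) / k       ≡⟨ +-distrib-/-∣ˡ b (divides-refl v) ⟩
  v * k / k + b / k     ≡⟨ cong₂ _+_ (m*n/n≡m v k) (m<n⇒m/n≡0 b<k) ⟩
  v + 0                 ≡⟨ +-identityʳ v ⟩
  v                     ∎
  where
  open ≡-Reasoning

same-block : ∀ m n k .{{_ : NonZero k}} → m / k ≡ n / k → n < m + k
same-block m n k eq = begin-strict
  n                     ≡⟨ m≡m%n+[m/n]*n n k ⟩
  n % k + n / k * k     <⟨ +-monoˡ-< (n / k * k) (m%n<n n k) ⟩
  k + n / k * k         ≡⟨ cong (λ q → k + q * k) eq ⟨
  k + m / k * k         ≤⟨ +-monoʳ-≤ k (m/n*n≤m m k) ⟩
  k + m                 ≡⟨ +-comm k m ⟩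
  m + k                 ∎
  where open ≤-Reasoning

≫-+ : ∀ m i o → m ≫ (i + o) ≡ m ≫ i ≫ o
≫-+ m i o = trans (/-congʳ (^-distribˡ-+-* 2 i o)) (sym (m/n/o≡m/[n*o] m (2 ^ i) (2 ^ o)))
  where
  instance
    i≢0 : NonZero (2 ^ i)
    i≢0 = m^n≢0 2 i
    o≢0 : NonZero (2 ^ o)
    o≢0 = m^n≢0 2 o
    i+o≢0 : NonZero (2 ^ (i + o))
    i+o≢0 = m^n≢0 2 (i + o)
    prod≢0 : NonZero (2 ^ i * 2 ^ o)
    prod≢0 = m*n≢0 (2 ^ i) (2 ^ o)

≫-suc : ∀ m i → m ≫ suc i ≡ m ≫ i / 2
≫-suc m i = trans (cong (m ≫_) (+-comm 1 i)) (≫-+ m i 1)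

≫-coarsen : ∀ m n i q → i ≤ q → m ≫ i ≡ n ≫ i → m ≫ q ≡ n ≫ q
≫-coarsen m n i q i≤q eq with m≤n⇒∃[o]m+o≡n i≤q
... | o , refl = trans (≫-+ m i o) (trans (cong (_≫ o) eq) (sym (≫-+ n i o)))

≫-mono : ∀ {m n} i → m ≤ n → m ≫ i ≤ n ≫ i
≫-mono i = /-monoˡ-≤ (2 ^ i) {{m^n≢0 2 i}}

≫-block : ∀ v i b → b < 2 ^ i → (v * 2 ^ i + b) ≫ i ≡ v
≫-block v i b b< = block-/ v (2 ^ i) b b< {{m^n≢0 2 i}}

≫-diameter : ∀ m n i → m ≫ i ≡ n ≫ i → n < m + 2 ^ i
≫-diameter m n i = same-block m n (2 ^ i) {{m^n≢0 2 i}}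

-- r is obtained from v by raising the binary digit number i from 0 to 1
-- and changing the lower digits arbitrarily.
record Above (i v r : ℕ) : Set where
  constructor above
  field
    digit : isEven (v ≫ i) ≡ true
    next  : r ≫ i ≡ suc (v ≫ i)

open Above

-- An even number and its successor have the same half, so the digits above `i` agree.
Above-coarse : ∀ {i v r} q → Above i v r → i < q → v ≫ q ≡ r ≫ q
Above-coarse {i} {v} {r} q (above ev nx) i<q = ≫-coarsen v r (suc i) q i<q
  (trans (≫-suc v i) (trans (half (v ≫ i) ev) (trans (cong (_/ 2) (sym nx)) (sym (≫-suc r i)))))
  where
  half : ∀ n → isEven n ≡ true → n / 2 ≡ suc n / 2
  half n ev with isEven⇒double n ev
  ... | a , refl = trans (m*n/n≡m a 2) (sym (trans (cong (_/ 2) (+-comm 1 (a * 2))) (block-/ a 2 1 (s≤s (s≤s z≤n)))))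

-- At `j` the prefixes would be equal by the first hypothesis and consecutive by the second. Hence
-- the choice at the end in A puts an edge into at most one class.
Above-unique : ∀ {i j v r} → Above i v r → Above j v r → ¬ i < j
Above-unique {j = j} A B i<j = 1+n≢n (trans (sym (next B)) (sym (Above-coarse j A i<j)))

isAbove : ℕ → ℕ → ℕ → Bool
isAbove i v r = isEven (v ≫ i) ∧ does (r ≫ i ≟ suc (v ≫ i))

isAbove⇒Above : ∀ i v r → isAbove i v r ≡ true → Above i v r
isAbove⇒Above i v r p = above (proj₁ (∧-true p)) (from-does (r ≫ i ≟ suc (v ≫ i)) (proj₂ (∧-true p)))

above-params-≤ : ∀ N i v → ∑ (upTo N) (𝟙 ∘ isAbove i v) ≤ 2 ^ i
above-params-≤ N i v = ∑-upTo-diameter N (2 ^ i) (isAbove i v) λ r r' p p' →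
  ≫-diameter r r' i (trans (next (isAbove⇒Above i v r p)) (sym (next (isAbove⇒Above i v r' p'))))

below-params-≤ : ∀ N i s r → ∑ (upTo N) (λ u → 𝟙 (isAbove i (u + s) r)) ≤ 2 ^ i
below-params-≤ N i s r = ∑-upTo-diameter N (2 ^ i) (λ u → isAbove i (u + s) r) λ u u' p p' →
  +-cancelʳ-< s u' (u + 2 ^ i) (subst (u' + s <_) (swap-last u s (2 ^ i)) (≫-diameter (u + s) (u' + s) i
    (suc-injective (trans (sym (next (isAbove⇒Above i (u + s) r p))) (next (isAbove⇒Above i (u' + s) r p'))))))
  where
  swap-last : ∀ a b c → a + b + c ≡ a + c + b
  swap-last = solve-∀

-- The good `r` form the block of length `2 ^ i` with prefix `suc w`. The block fits because an even
-- `w` below `2 ^ suc a` is at most `2 ^ suc a - 2`, where `i + a ≡ h`.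
above-params-≥ : ∀ h i v → i < h → v < 2 ^ suc h → isEven (v ≫ i) ≡ true →
  2 ^ i ≤ ∑ (upTo (2 ^ suc h)) (𝟙 ∘ isAbove i v)
above-params-≥ h i v i<h v< ev = ∑-upTo-≥ (2 ^ suc h) (suc w * 2 ^ i) (2 ^ i) (isAbove i v) fits inside
  where
  w = v ≫ i
  inside : ∀ b → b < 2 ^ i → isAbove i v (suc w * 2 ^ i + b) ≡ true
  inside b b< = cong₂ _∧_ ev (dec-true ((suc w * 2 ^ i + b) ≫ i ≟ suc w) (≫-block (suc w) i b b<))
  power : ∀ a → i + a ≡ h → 2 ^ suc h ≡ 2 ^ suc a * 2 ^ i
  power a refl = trans (cong (2 ^_) (cong suc (+-comm i a))) (^-distribˡ-+-* 2 (suc a) i)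
  fits : suc w * 2 ^ i + 2 ^ i ≤ 2 ^ suc h
  fits with m≤n⇒∃[o]m+o≡n (<⇒≤ i<h) | isEven⇒double w ev
  ... | a , i+a≡h | b , w≡2b = begin
    suc w * 2 ^ i + 2 ^ i   ≡⟨ +-comm (suc w * 2 ^ i) (2 ^ i) ⟩
    suc (suc w) * 2 ^ i     ≡⟨ cong (λ n → suc (suc n) * 2 ^ i) w≡2b ⟩
    suc b * 2 * 2 ^ i       ≤⟨ *-monoˡ-≤ (2 ^ i) (*-monoˡ-≤ 2 b<) ⟩
    2 ^ a * 2 * 2 ^ i       ≡⟨ cong (_* 2 ^ i) (*-comm (2 ^ a) 2) ⟩
    2 ^ suc a * 2 ^ i       ≡⟨ power a i+a≡h ⟨
    2 ^ suc h               ∎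
    where
    open ≤-Reasoning
    b< : suc b ≤ 2 ^ a
    b< = *-cancelʳ-< 2 b (2 ^ a) (begin-strict
      b * 2      ≡⟨ w≡2b ⟨
      w          <⟨ m<n*o⇒m/o<n {{m^n≢0 2 i}} (subst (v <_) (power a i+a≡h) v<) ⟩
      2 ^ suc a  ≡⟨ *-comm 2 (2 ^ a) ⟩
      2 ^ a * 2  ∎)

-- Adding `2 ^ i` flips digit `i`, so it is 0 on exactly half of every stretch of length
-- `2 ^ suc i`; as `i < h`, such stretches tile the range of `s`.
even-shifts : ∀ h i c → i < h → 2 * ∑ (upTo (2 ^ h)) (λ s → 𝟙 (isEven ((c + s) ≫ i))) ≡ 2 ^ h
even-shifts h i c i<h with m≤n⇒∃[o]m+o≡n i<h
... | a , refl = begin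
  2 * ∑ (upTo (2 ^ (suc i + a))) g
    ≡⟨ cong (λ N → 2 * ∑ (upTo N) g) size ⟩
  2 * ∑ (upTo (2 ^ a * (P + P))) g
    ≡⟨ cong (2 *_) (∑-upTo-* (2 ^ a) (P + P) g) ⟩
  2 * ∑ (upTo (2 ^ a)) (λ u → ∑ (upTo (P + P)) (λ l → g (u * (P + P) + l)))
    ≡⟨ cong (2 *_) (∑-cong (upTo (2 ^ a)) (λ u → period (u * (P + P)))) ⟩
  2 * ∑ (upTo (2 ^ a)) (λ _ → P)
    ≡⟨ cong (2 *_) (trans (∑-const (upTo (2 ^ a)) P) (cong (_* P) (length-applyUpTo id (2 ^ a)))) ⟩
  2 * (2 ^ a * P)
    ≡⟨ double (2 ^ a) P ⟩
  2 ^ a * (P + P)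
    ≡⟨ size ⟨
  2 ^ (suc i + a) ∎
  where
  open ≡-Reasoning
  P = 2 ^ i
  g : ℕ → ℕ
  g s = 𝟙 (isEven ((c + s) ≫ i))
  double : ∀ A P → 2 * (A * P) ≡ A * (P + P)
  double = solve-∀
  size : 2 ^ (suc i + a) ≡ 2 ^ a * (P + P)
  size = trans (cong (2 *_) (trans (cong (2 ^_) (+-comm i a)) (^-distribˡ-+-* 2 a i))) (double (2 ^ a) P)
  complement : ∀ n → 𝟙 (isEven n) + 𝟙 (isEven (suc n)) ≡ 1
  complement n with isEven n
  ... | true  = refl
  ... | false = refl
  next-block : ∀ z l → (c + (z + (P + l))) ≫ i ≡ suc ((c + (z + l)) ≫ i)
  next-block z l = trans (cong (_≫ i) (shift c z P l)) (trans (m/n≡1+[m∸n]/n {{m^n≢0 2 i}} (m≤m+n P (c + (z + l)))) (cong (λ n → suc (n ≫ i)) (m+n∸m≡n P (c + (z + l)))))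
    where
    shift : ∀ c z P l → c + (z + (P + l)) ≡ P + (c + (z + l))
    shift = solve-∀
  period : ∀ z → ∑ (upTo (P + P)) (λ l → g (z + l)) ≡ P
  period z = begin
    ∑ (upTo (P + P)) (λ l → g (z + l))
      ≡⟨ ∑-upTo-split P P _ ⟩
    ∑ (upTo P) (λ l → g (z + l)) + ∑ (upTo P) (λ l → g (z + (P + l)))
      ≡⟨ ∑-+ (upTo P) _ _ ⟨
    ∑ (upTo P) (λ l → g (z + l) + g (z + (P + l)))
      ≡⟨ ∑-cong (upTo P) (λ l → trans (cong (λ n → g (z + l) + 𝟙 (isEven n)) (next-block z l)) (complement ((c + (z + l)) ≫ i))) ⟩
    ∑ (upTo P) (λ _ → 1)
      ≡⟨ trans (∑-const (upTo P) 1) (trans (*-identityʳ _) (length-applyUpTo id P)) ⟩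
    P ∎

-- One thinning step

Lt : Bool → ℕ → ℕ → Set
Lt true  a b = a < b
Lt false a b = b < a

Lt-irrefl : ∀ σ {n} → ¬ Lt σ n n
Lt-irrefl true  = <-irrefl refl
Lt-irrefl false = <-irrefl refl

inWindow : ℕ → ℕ → ℕ → Bool
inWindow a l ρ = does (l + a ≤? ρ) ∧ does (ρ <? l + a + a)

inWindow⇒ : ∀ a l ρ → inWindow a l ρ ≡ true → l + a ≤ ρ × ρ < l + a + a
inWindow⇒ a l ρ p = from-does (l + a ≤? ρ) (proj₁ (∧-true p)) , from-does (ρ <? l + a + a) (proj₂ (∧-true {does (l + a ≤? ρ)} p))

⇒inWindow : ∀ a l ρ → l + a ≤ ρ → ρ < l + a + a → inWindow a l ρ ≡ true
⇒inWindow a l ρ p q = cong₂ _∧_ (dec-true (l + a ≤? ρ) p) (dec-true (ρ <? l + a + a) q)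

-- The offset T in the second case keeps ρ from becoming negative.
window : Bool → ℕ → ℕ → ℕ → ℕ → Bool
window true  T a l ρ = inWindow a l ρ
window false T a l ρ = inWindow a ρ (l + T)

window-params-≤ : ∀ σ N T a l → ∑ (upTo N) (𝟙 ∘ window σ T a l) ≤ a
window-params-≤ true N T a l = ∑-upTo-diameter N a _ λ ρ ρ' p p' →
  <-≤-trans (proj₂ (inWindow⇒ a l ρ' p')) (+-monoˡ-≤ a (proj₁ (inWindow⇒ a l ρ p)))
window-params-≤ false N T a l = ∑-upTo-diameter N a _ λ ρ ρ' p p' →
  +-cancelʳ-< a ρ' (ρ + a) (≤-<-trans (proj₁ (inWindow⇒ a ρ' (l + T) p')) (proj₂ (inWindow⇒ a ρ (l + T) p)))

window-lows-≤ : ∀ σ N T a ρ → ∑ (upTo N) (λ l → 𝟙 (window σ T a l ρ)) ≤ a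
window-lows-≤ true N T a ρ = ∑-upTo-diameter N a _ λ l l' p p' →
  +-cancelʳ-< a l' (l + a) (≤-<-trans (proj₁ (inWindow⇒ a l' ρ p')) (proj₂ (inWindow⇒ a l ρ p)))
window-lows-≤ false N T a ρ = ∑-upTo-diameter N a _ λ l l' p p' →
  +-cancelʳ-< T l' (l + a) (subst (l' + T <_) (swap-last l T a)
    (<-≤-trans (proj₂ (inWindow⇒ a ρ (l' + T) p')) (+-monoˡ-≤ a (proj₁ (inWindow⇒ a ρ (l + T) p)))))
  where
  swap-last : ∀ a b c → a + b + c ≡ a + c + b
  swap-last = solve-∀

window-params-≥ : ∀ σ T a l → a + a ≤ T → l < T → a ≤ ∑ (upTo (T + T)) (𝟙 ∘ window σ T a l)
window-params-≥ true T a l 2a≤T l<T = ∑-upTo-≥ (T + T) (l + a) a (window true T a l)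
  (subst (_≤ T + T) (sym (+-assoc l a a)) (+-mono-≤ (<⇒≤ l<T) 2a≤T))
  (λ b b<a → ⇒inWindow a l (l + a + b) (m≤m+n (l + a) b) (+-monoʳ-< (l + a) b<a))
window-params-≥ false T a l 2a≤T l<T with m≤n⇒∃[o]m+o≡n 2a≤T
-- With `T = a + a + e` the condition reads `l + e < ρ ≤ l + e + a`; the strict lower end accounts
-- for the `suc`.
... | e , refl = ∑-upTo-≥ (T + T) (suc (l + e)) a (window false T a l)
  (begin
    suc (l + e) + a              ≡⟨ cong suc (+-assoc l e a) ⟩
    suc l + (e + a)              ≤⟨ +-mono-≤ l<T (≤-trans (m≤n+m (e + a) a) (≤-reflexive (rot a e))) ⟩
    T + T                        ∎)
  (λ b b<a → ⇒inWindow a (suc (l + e) + b) (l + T)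
    (begin
      suc (l + e) + b + a        ≡⟨ left l e b a ⟩
      l + e + a + suc b          ≤⟨ +-monoʳ-≤ (l + e + a) b<a ⟩
      l + e + a + a              ≡⟨ right l e a ⟩
      l + T                      ∎)
    (begin
      suc (l + T)                ≡⟨ over l a e ⟩
      suc (l + e) + a + a        ≤⟨ +-monoˡ-≤ a (+-monoˡ-≤ a (m≤m+n (suc (l + e)) b)) ⟩
      suc (l + e) + b + a + a    ∎))
  where
  open ≤-Reasoning
  rot : ∀ a e → a + (e + a) ≡ a + a + e
  rot = solve-∀
  left : ∀ l e b a → suc (l + e) + b + a ≡ l + e + a + suc b
  left = solve-∀
  right : ∀ l e a → l + e + a + a ≡ l + (a + a + e)
  right = solve-∀
  over : ∀ l a e → suc (l + (a + a + e)) ≡ suc (l + e) + a + a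
  over = solve-∀

-- Passing from `l` to `l'` in direction `σ` shortens the distance to `ρ`, which is below `a + a` at
-- first and at least `a'` afterwards. For widths that are powers of two this means that the width
-- does not grow.
window-order : ∀ σ T a a' l l' ρ → window σ T a l ρ ≡ true → window σ T a' l' ρ ≡ true → Lt σ l l' → ¬ a + a ≤ a'
window-order true T a a' l l' ρ p p' l<l' le = <-irrefl refl (begin-strict
  ρ              <⟨ proj₂ (inWindow⇒ a l ρ p) ⟩
  l + a + a      ≡⟨ +-assoc l a a ⟩
  l + (a + a)    ≤⟨ +-mono-≤ (<⇒≤ l<l') le ⟩
  l' + a'        ≤⟨ proj₁ (inWindow⇒ a' l' ρ p') ⟩
  ρ              ∎)
  where open ≤-Reasoning
window-order false T a a' l l' ρ p p' l'<l le = <-irrefl refl (begin-strict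
  l + T          <⟨ proj₂ (inWindow⇒ a ρ (l + T) p) ⟩
  ρ + a + a      ≡⟨ +-assoc ρ a a ⟩
  ρ + (a + a)    ≤⟨ +-monoʳ-≤ ρ le ⟩
  ρ + a'         ≤⟨ proj₁ (inWindow⇒ a' ρ (l' + T) p') ⟩
  l' + T         ≤⟨ +-monoˡ-≤ T (<⇒≤ l'<l) ⟩
  l + T          ∎)
  where open ≤-Reasoning

-- Colours start at 1, so the class of an edge of colour q is pred q.
level : ℕ → ℕ → ℕ
level q u = u ≫ pred q

-- All that the walk argument needs of the random choices. The last two fields locate the change of
-- height at a vertex in A: the prefix cut at the class of the edge of smaller colour goes up by
-- one, and shorter prefixes stay.
record Thinned {na nb} (σ : Bool) (E : EdgeSet na nb) (χ : Colouring na nb) (d h : ℕ) : Set where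
  field
    E₁      : EdgeSet na nb
    D       : Colouring na nb
    height  : Fin na → Fin nb → ℕ
    E₁⊆E    : E₁ ⊆ᴱ E
    proper  : IsProperColouring E₁ h D
    dense   : h * edgeCount E ≤ 120 * (d * edgeCount E₁)
    height-mono : ∀ x y x' y' → χ x y ≤ χ x' y' → height x y ≤ height x' y'
    height-B : ∀ x x' y → E₁ x y ≡ true → E₁ x' y ≡ true → height x y ≡ height x' y
    class-B  : ∀ x x' y → E₁ x y ≡ true → E₁ x' y ≡ true → Lt σ (χ x y) (χ x' y) → D x y < D x' y
    class-A  : ∀ x y y' → E₁ x y ≡ true → E₁ x y' ≡ true → χ x y < χ x y' → D x y' < D x y
    height-A : ∀ x y y' → E₁ x y ≡ true → E₁ x y' ≡ true → χ x y < χ x y' →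
      level (D x y) (height x y') ≡ suc (level (D x y) (height x y))
    height-A-coarse : ∀ x y y' → E₁ x y ≡ true → E₁ x y' ≡ true → χ x y < χ x y' →
      ∀ q → D x y < q → level q (height x y') ≡ level q (height x y)

-- Colours are numbers of `h` high and `t` low binary digits. `M≤2d` limits the loss from rounding
-- up to a power of two, and `h≤t` makes the widest window, which reaches up to distance `2 ^ h`,
-- fit into `T`.
module Construction {na nb : ℕ} (σ : Bool) (E : EdgeSet na nb) (χ : Colouring na nb) (d h' t : ℕ)
  (isProper : IsProperColouring E d χ)
  (h≤t : suc h' ≤ t) (d<M : d < 2 ^ suc h' * 2 ^ t) (M≤2d : 2 ^ suc h' * 2 ^ t ≤ 2 * d) where

  private
    h = suc h'
    T = 2 ^ t

    instance
      T≢0 : NonZero T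
      T≢0 = m^n≢0 2 t

    base : Fin na → Fin nb → ℕ
    base x y = χ x y ≫ t

    χ<M : ∀ x y → E x y ≡ true → χ x y < 2 ^ h * T
    χ<M x y e = ≤-<-trans (proj₂ (proj₁ isProper x y e)) d<M

    χ-injᴬ : ∀ x y y' → E x y ≡ true → E x y' ≡ true → χ x y ≡ χ x y' → y ≡ y'
    χ-injᴬ x y y' e e' eq with y Fin.≟ y'
    ... | yes p = p
    ... | no  p = contradiction eq (proj₁ (proj₂ isProper) x y y' e e' p)

    χ-injᴮ : ∀ y x x' → E x y ≡ true → E x' y ≡ true → χ x y ≡ χ x' y → x ≡ x'
    χ-injᴮ y x x' e e' eq with x Fin.≟ x'
    ... | yes p = p
    ... | no  p = contradiction eq (proj₂ (proj₂ isProper) x x' y e e' p)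

    evens : ℕ → ℕ
    evens s = ∑ (allFin na) λ x → ∑ (allFin nb) λ y → 𝟙 (E x y) * ∑ (upTo h) (λ i → 𝟙 (isEven ((base x y + s) ≫ i)))

    -- An edge can be raised only at digits 0 of its height. By `even-shifts` half of its `h` digits
    -- are such on average over `s`.
    good-shift : ∃ λ s → s < 2 ^ h × h * edgeCount E ≤ 2 * evens s
    good-shift = proj₁ choice , ∈-upTo⁻ (proj₁ (proj₂ choice)) , proj₂ (proj₂ choice)
      where
      open ≤-Reasoning
      S = upTo (2 ^ h)
      ev : Fin na → Fin nb → ℕ → ℕ → ℕ
      ev x y s i = 𝟙 (isEven ((base x y + s) ≫ i))
      pointwise : ∀ x y → ∑ S (λ s → ∑ (upTo h) (ev x y s)) * 2 ≡ h * 2 ^ h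
      pointwise x y = begin-equality
        ∑ S (λ s → ∑ (upTo h) (ev x y s)) * 2      ≡⟨ *-comm (∑ S (λ s → ∑ (upTo h) (ev x y s))) 2 ⟩
        2 * ∑ S (λ s → ∑ (upTo h) (ev x y s))      ≡⟨ cong (2 *_) (∑-swap S (upTo h) (ev x y)) ⟩
        2 * ∑ (upTo h) (λ i → ∑ S (λ s → ev x y s i)) ≡⟨ ∑-*ˡ (upTo h) 2 (λ i → ∑ S (λ s → ev x y s i)) ⟨
        ∑ (upTo h) (λ i → 2 * ∑ S (λ s → ev x y s i)) ≡⟨ ∑-cong-∈ (upTo h) (λ i i∈ → even-shifts h i (base x y) (∈-upTo⁻ i∈)) ⟩
        ∑ (upTo h) (λ _ → 2 ^ h)                   ≡⟨ trans (∑-const (upTo h) (2 ^ h)) (cong (_* 2 ^ h) (length-applyUpTo id h)) ⟩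
        h * 2 ^ h                                  ∎
      average : length S * (h * edgeCount E) ≤ 2 * ∑ S evens
      average = ≤-reflexive (begin-equality
        length S * (h * edgeCount E)
          ≡⟨ cong (_* (h * edgeCount E)) (length-applyUpTo id (2 ^ h)) ⟩
        2 ^ h * (h * edgeCount E)
          ≡⟨ rotate (2 ^ h) h (edgeCount E) ⟩
        edgeCount E * (h * 2 ^ h)
          ≡⟨ trans (∑-cong (allFin na) λ x → ∑-*ʳ (allFin nb) (h * 2 ^ h) (λ y → 𝟙 (E x y))) (∑-*ʳ (allFin na) (h * 2 ^ h) _) ⟨
        (∑ (allFin na) λ x → ∑ (allFin nb) λ y → 𝟙 (E x y) * (h * 2 ^ h))
          ≡⟨ (∑-cong (allFin na) λ x → ∑-cong (allFin nb) λ y → trans (cong (𝟙 (E x y) *_) (sym (pointwise x y)))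
               (trans (sym (*-assoc (𝟙 (E x y)) _ 2)) (cong (_* 2) (sym (∑-*ˡ S (𝟙 (E x y)) (λ s → ∑ (upTo h) (ev x y s))))))) ⟩
        (∑ (allFin na) λ x → ∑ (allFin nb) λ y → (∑ S λ s → 𝟙 (E x y) * ∑ (upTo h) (ev x y s)) * 2)
          ≡⟨ trans (∑-cong (allFin na) λ x → ∑-*ʳ (allFin nb) 2 (λ y → ∑ S λ s → 𝟙 (E x y) * ∑ (upTo h) (ev x y s))) (∑-*ʳ (allFin na) 2 _) ⟩
        (∑ (allFin na) λ x → ∑ (allFin nb) λ y → ∑ S λ s → 𝟙 (E x y) * ∑ (upTo h) (ev x y s)) * 2
          ≡⟨ cong (_* 2) (trans (∑-cong (allFin na) λ x → ∑-swap (allFin nb) S (λ y s → 𝟙 (E x y) * ∑ (upTo h) (ev x y s)))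
               (∑-swap (allFin na) S _)) ⟩
        ∑ S evens * 2
          ≡⟨ *-comm (∑ S evens) 2 ⟩
        2 * ∑ S evens ∎)
        where
        rotate : ∀ a b c → a * (b * c) ≡ c * (b * a)
        rotate = solve-∀
      choice = pigeonhole S 2 (h * edgeCount E) evens (subst (1 ≤_) (sym (length-applyUpTo id (2 ^ h))) (m^n>0 2 h)) average

  module Shifted (s : ℕ) (s<2^h : s < 2 ^ h) (evens-≥ : h * edgeCount E ≤ 2 * evens s) where

    height : Fin na → Fin nb → ℕ
    height x y = base x y + s

    -- The widths balance the classes: an even digit `i` is hit by `2 ^ i` choices at A and by `a i`
    -- choices at B, and the product is `2 ^ h'` for every `i`.
    a : ℕ → ℕ
    a i = 2 ^ (h' ∸ i)

    -- Hits are functions of the colour `c` alone, so that `∑-injective` applies to them.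
    hitᴬ : ℕ → ℕ → ℕ → Bool
    hitᴬ c i r = isAbove i (c ≫ t + s) r

    hitᴮ : ℕ → ℕ → ℕ × ℕ → Bool
    hitᴮ c i (u , ρ) = does (c ≫ t + s ≟ u) ∧ window σ T (a i) (c % T) ρ

    -- High halves and the shift are both below `2 ^ h`, so heights stay below `2 ^ suc h`.
    ps : List ℕ
    ps = upTo (2 ^ suc h)

    qs : List (ℕ × ℕ)
    qs = cartesianProduct (upTo (2 ^ suc h)) (upTo (T + T))

    height< : ∀ x y → E x y ≡ true → height x y < 2 ^ suc h
    height< x y e = subst (height x y <_) (cong (2 ^ h +_) (sym (+-identityʳ (2 ^ h))))
      (+-mono-< (m<n*o⇒m/o<n {n = 2 ^ h} (χ<M x y e)) s<2^h)

    params-B-≡ : ∀ c i → ∑ qs (𝟙 ∘ hitᴮ c i) ≡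
      ∑ (upTo (2 ^ suc h)) (λ u → 𝟙 (does (c ≫ t + s ≟ u))) * ∑ (upTo (T + T)) (𝟙 ∘ window σ T (a i) (c % T))
    params-B-≡ c i = begin
      ∑ qs (𝟙 ∘ hitᴮ c i)
        ≡⟨ ∑-product _,_ (upTo (2 ^ suc h)) (upTo (T + T)) (𝟙 ∘ hitᴮ c i) ⟩
      ∑ (upTo (2 ^ suc h)) (λ u → ∑ (upTo (T + T)) (λ ρ → 𝟙 (hitᴮ c i (u , ρ))))
        ≡⟨ ∑-cong (upTo (2 ^ suc h)) (λ u → trans (∑-cong (upTo (T + T)) (λ ρ → 𝟙-∧ (does (c ≫ t + s ≟ u)) _))
             (∑-*ˡ (upTo (T + T)) (𝟙 (does (c ≫ t + s ≟ u))) _)) ⟩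
      ∑ (upTo (2 ^ suc h)) (λ u → 𝟙 (does (c ≫ t + s ≟ u)) * ∑ (upTo (T + T)) (𝟙 ∘ window σ T (a i) (c % T)))
        ≡⟨ ∑-*ʳ (upTo (2 ^ suc h)) _ (λ u → 𝟙 (does (c ≫ t + s ≟ u))) ⟩
      _ ∎
      where open ≡-Reasoning

    paramsᴬ : ∀ c i → ∑ ps (𝟙 ∘ hitᴬ c i) ≤ 2 ^ i
    paramsᴬ c i = above-params-≤ (2 ^ suc h) i (c ≫ t + s)

    paramsᴮ : ∀ c i → ∑ qs (𝟙 ∘ hitᴮ c i) ≤ a i
    paramsᴮ c i = begin
      ∑ qs (𝟙 ∘ hitᴮ c i)  ≡⟨ params-B-≡ c i ⟩
      _                    ≤⟨ *-mono-≤ (∑-upTo-diameter (2 ^ suc h) 1 (λ u → does (c ≫ t + s ≟ u)) λ u u' p p' →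
                                ≤-reflexive (trans (cong suc (trans (sym (from-does (c ≫ t + s ≟ u') p')) (from-does (c ≫ t + s ≟ u) p))) (+-comm 1 u)))
                              (window-params-≤ σ (T + T) T (a i) (c % T)) ⟩
      1 * a i              ≡⟨ *-identityˡ (a i) ⟩
      a i                  ∎
      where open ≤-Reasoning

    digits : ∀ (f : ℕ → ℕ → ℕ) → ∑ (upTo (2 ^ h * T)) (λ c → f (c ≫ t) (c % T)) ≡ ∑ (upTo (2 ^ h)) λ u → ∑ (upTo T) (f u)
    digits f = trans (∑-upTo-* (2 ^ h) T _) (∑-cong (upTo (2 ^ h)) λ u → ∑-cong-∈ (upTo T) λ l l∈ →
      cong₂ f (≫-block u t l (∈-upTo⁻ l∈))
        (trans (cong (_% T) (+-comm (u * T) l)) (trans ([m+kn]%n≡m%n l u T) (m<n⇒m%n≡m (∈-upTo⁻ l∈)))))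

    -- The low half is free, which gives `T`; the high half is confined to a block of length
    -- `2 ^ i`, since `r` determines its prefix.
    degreeᴬ : ∀ x i r → ∑ (allFin nb) (λ y → 𝟙 (E x y) * 𝟙 (hitᴬ (χ x y) i r)) ≤ T * 2 ^ i
    degreeᴬ x i r = begin
      ∑ (allFin nb) (λ y → 𝟙 (E x y) * 𝟙 (hitᴬ (χ x y) i r))
        ≤⟨ ∑-injective nb (2 ^ h * T) (E x) (χ x) (λ c → 𝟙 (hitᴬ c i r)) (χ<M x) (χ-injᴬ x) ⟩
      ∑ (upTo (2 ^ h * T)) (λ c → 𝟙 (hitᴬ c i r))
        ≡⟨ digits (λ u _ → 𝟙 (isAbove i (u + s) r)) ⟩
      ∑ (upTo (2 ^ h)) (λ u → ∑ (upTo T) (λ _ → 𝟙 (isAbove i (u + s) r)))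
        ≡⟨ ∑-swap (upTo (2 ^ h)) (upTo T) _ ⟩
      ∑ (upTo T) (λ _ → ∑ (upTo (2 ^ h)) (λ u → 𝟙 (isAbove i (u + s) r)))
        ≡⟨ trans (∑-const (upTo T) _) (cong (_* ∑ (upTo (2 ^ h)) (λ u → 𝟙 (isAbove i (u + s) r))) (length-applyUpTo id T)) ⟩
      T * ∑ (upTo (2 ^ h)) (λ u → 𝟙 (isAbove i (u + s) r))
        ≤⟨ *-monoʳ-≤ T (below-params-≤ (2 ^ h) i s r) ⟩
      T * 2 ^ i ∎
      where open ≤-Reasoning

    -- The chosen height determines the high half, and `ρ` confines the low half to an interval of
    -- length `a i`.
    degreeᴮ : ∀ y i q → ∑ (allFin na) (λ x → 𝟙 (E x y) * 𝟙 (hitᴮ (χ x y) i q)) ≤ a i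
    degreeᴮ y i (v , ρ) = begin
      ∑ (allFin na) (λ x → 𝟙 (E x y) * 𝟙 (hitᴮ (χ x y) i (v , ρ)))
        ≤⟨ ∑-injective na (2 ^ h * T) (λ x → E x y) (λ x → χ x y) (λ c → 𝟙 (hitᴮ c i (v , ρ))) (λ x → χ<M x y) (χ-injᴮ y) ⟩
      ∑ (upTo (2 ^ h * T)) (λ c → 𝟙 (hitᴮ c i (v , ρ)))
        ≡⟨ digits (λ u l → 𝟙 (does (u + s ≟ v) ∧ window σ T (a i) l ρ)) ⟩
      ∑ (upTo (2 ^ h)) (λ u → ∑ (upTo T) (λ l → 𝟙 (does (u + s ≟ v) ∧ window σ T (a i) l ρ)))
        ≡⟨ ∑-cong (upTo (2 ^ h)) (λ u → trans (∑-cong (upTo T) (λ l → 𝟙-∧ (does (u + s ≟ v)) _))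
             (∑-*ˡ (upTo T) (𝟙 (does (u + s ≟ v))) _)) ⟩
      ∑ (upTo (2 ^ h)) (λ u → 𝟙 (does (u + s ≟ v)) * ∑ (upTo T) (λ l → 𝟙 (window σ T (a i) l ρ)))
        ≡⟨ ∑-*ʳ (upTo (2 ^ h)) _ (λ u → 𝟙 (does (u + s ≟ v))) ⟩
      ∑ (upTo (2 ^ h)) (λ u → 𝟙 (does (u + s ≟ v))) * ∑ (upTo T) (λ l → 𝟙 (window σ T (a i) l ρ))
        ≤⟨ *-mono-≤ (∑-upTo-diameter (2 ^ h) 1 (λ u → does (u + s ≟ v)) (λ u u' p p' →
             ≤-reflexive (trans (cong suc (+-cancelʳ-≡ s u' u (trans (from-does (u' + s ≟ v) p') (sym (from-does (u + s ≟ v) p))))) (+-comm 1 u))))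
             (window-lows-≤ σ T T (a i) ρ) ⟩
      1 * a i
        ≡⟨ *-identityˡ (a i) ⟩
      a i ∎
      where open ≤-Reasoning

    length-ps : length ps ≡ 4 * 2 ^ h'
    length-ps = trans (length-applyUpTo id (2 ^ suc h)) (quadruple (2 ^ h'))
      where
      quadruple : ∀ H → 2 * (2 * H) ≡ 4 * H
      quadruple = solve-∀

    length-qs : length qs ≡ 4 * 2 ^ h' * (2 * T)
    length-qs = trans (length-product _,_ (upTo (2 ^ suc h)) (upTo (T + T))) (cong₂ _*_ length-ps
      (trans (length-applyUpTo id (T + T)) (cong (T +_) (sym (+-identityʳ T)))))

    instance
      H≢0 : NonZero (2 ^ h')
      H≢0 = m^n≢0 2 h'
      ps≢0 : NonZero (length ps)
      ps≢0 = subst NonZero (sym length-ps) (m*n≢0 4 (2 ^ h'))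
      qs≢0 : NonZero (length qs)
      qs≢0 = subst NonZero (sym length-qs) (m*n≢0 (4 * 2 ^ h') (2 * T) {{m*n≢0 4 (2 ^ h')}} {{m*n≢0 2 T}})

    a-2^i : ∀ i → i < h → a i * 2 ^ i ≡ 2 ^ h'
    a-2^i i (s≤s i≤h') = trans (sym (^-distribˡ-+-* 2 (h' ∸ i) i)) (cong (2 ^_) (m∸n+n≡m i≤h'))

    -- An equality for every `i`, by the balance of the widths; the constants 8 and 4 come from the
    -- sizes of `qs` and `ps`.
    sparseᴬ : ∀ i → i < h → 8 * (T * 2 ^ i * a i) ≤ length qs
    sparseᴬ i i<h = ≤-reflexive (trans (arrange T (2 ^ i) (a i)) (trans (cong (λ H → 4 * H * (2 * T)) (a-2^i i i<h)) (sym length-qs)))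
      where
      arrange : ∀ T P a → 8 * (T * P * a) ≡ 4 * (a * P) * (2 * T)
      arrange = solve-∀

    sparseᴮ : ∀ i → i < h → 4 * (a i * 2 ^ i) ≤ length ps
    sparseᴮ i i<h = ≤-reflexive (trans (cong (4 *_) (a-2^i i i<h)) (sym length-ps))

    open Thinning ps qs E h (λ x y → hitᴬ (χ x y)) (λ x y → hitᴮ (χ x y))

    expected : ℕ
    expected = ∑ (allFin na) λ x → ∑ (allFin nb) λ y → ∑ (upTo h) λ i →
      𝟙 (E x y) * ∑ ps (𝟙 ∘ hitᴬ (χ x y) i) * ∑ qs (𝟙 ∘ hitᴮ (χ x y) i)

    params-B-≥ : ∀ x y i → E x y ≡ true → a i ≤ ∑ qs (𝟙 ∘ hitᴮ (χ x y) i)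
    params-B-≥ x y i e = begin
      a i                      ≡⟨ *-identityˡ (a i) ⟨
      1 * a i                  ≤⟨ *-mono-≤ hit-height (window-params-≥ σ T (a i) (χ x y % T) a+a≤T (m%n<n (χ x y) T)) ⟩
      _                        ≡⟨ params-B-≡ (χ x y) i ⟨
      ∑ qs (𝟙 ∘ hitᴮ (χ x y) i) ∎
      where
      open ≤-Reasoning
      hit-height : 1 ≤ ∑ (upTo (2 ^ suc h)) (λ u → 𝟙 (does (height x y ≟ u)))
      hit-height = ≤-trans (≤-reflexive (sym (cong 𝟙 (dec-true (height x y ≟ height x y) refl))))
        (∑-member (λ u → 𝟙 (does (height x y ≟ u))) (∈-upTo⁺ (height< x y e)))
      a+a≤T : a i + a i ≤ T
      a+a≤T = begin
        a i + a i           ≡⟨ cong (a i +_) (+-identityʳ (a i)) ⟨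
        2 ^ suc (h' ∸ i)    ≤⟨ ^-monoʳ-≤ 2 (≤-trans (s≤s (m∸n≤m h' i)) h≤t) ⟩
        T                   ∎

    -- Every even digit `i` of the height of an edge contributes at least `2 ^ i * a i` pairs of
    -- choices.
    expected-≥ : 2 ^ h' * evens s ≤ expected
    expected-≥ = begin
      2 ^ h' * evens s
        ≡⟨ trans (∑-cong (allFin na) λ x → ∑-*ˡ (allFin nb) (2 ^ h') _) (∑-*ˡ (allFin na) (2 ^ h') _) ⟨
      (∑ (allFin na) λ x → ∑ (allFin nb) λ y → 2 ^ h' * (𝟙 (E x y) * ∑ (upTo h) (ev x y)))
        ≡⟨ (∑-cong (allFin na) λ x → ∑-cong (allFin nb) λ y → trans (sym (*-assoc (2 ^ h') (𝟙 (E x y)) _)) (sym (∑-*ˡ (upTo h) (2 ^ h' * 𝟙 (E x y)) (ev x y)))) ⟩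
      (∑ (allFin na) λ x → ∑ (allFin nb) λ y → ∑ (upTo h) λ i → 2 ^ h' * 𝟙 (E x y) * ev x y i)
        ≤⟨ (∑-mono (allFin na) λ x → ∑-mono (allFin nb) λ y → ∑-mono-∈ (upTo h) λ i i∈ →
             pointwise x y i (∈-upTo⁻ i∈) (E x y) refl (isEven (height x y ≫ i)) refl) ⟩
      expected ∎
      where
      open ≤-Reasoning
      ev : Fin na → Fin nb → ℕ → ℕ
      ev x y i = 𝟙 (isEven (height x y ≫ i))
      pointwise : ∀ x y i → i < h → ∀ b → E x y ≡ b → ∀ b' → isEven (height x y ≫ i) ≡ b' →
        2 ^ h' * 𝟙 (E x y) * ev x y i ≤ 𝟙 (E x y) * ∑ ps (𝟙 ∘ hitᴬ (χ x y) i) * ∑ qs (𝟙 ∘ hitᴮ (χ x y) i)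
      pointwise x y i i<h false e _ _ = ≤-trans (≤-reflexive
        (trans (cong (λ b → 2 ^ h' * 𝟙 b * ev x y i) e) (cong (_* ev x y i) (*-zeroʳ (2 ^ h'))))) z≤n
      pointwise x y i i<h true e false o = ≤-trans (≤-reflexive
        (trans (cong (λ b → 2 ^ h' * 𝟙 (E x y) * 𝟙 b) o) (*-zeroʳ (2 ^ h' * 𝟙 (E x y))))) z≤n
      pointwise x y i i<h true e true o = begin
        2 ^ h' * 𝟙 (E x y) * ev x y i   ≡⟨ cong₂ (λ b b' → 2 ^ h' * 𝟙 b * 𝟙 b') e o ⟩
        2 ^ h' * 1 * 1                  ≡⟨ trans (*-identityʳ (2 ^ h' * 1)) (*-identityʳ (2 ^ h')) ⟩
        2 ^ h'                          ≡⟨ trans (sym (a-2^i i i<h)) (*-comm (a i) (2 ^ i)) ⟩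
        2 ^ i * a i                     ≤⟨ *-mono-≤ (above-params-≥ h i (height x y) i<h (height< x y e) o) (params-B-≥ x y i e) ⟩
        ∑ ps (𝟙 ∘ hitᴬ (χ x y) i) * ∑ qs (𝟙 ∘ hitᴮ (χ x y) i)
          ≡⟨ cong (_* ∑ qs (𝟙 ∘ hitᴮ (χ x y) i)) (trans (cong (λ b → 𝟙 b * ∑ ps (𝟙 ∘ hitᴬ (χ x y) i)) e) (*-identityˡ _)) ⟨
        𝟙 (E x y) * ∑ ps (𝟙 ∘ hitᴬ (χ x y) i) * ∑ qs (𝟙 ∘ hitᴮ (χ x y) i) ∎

    survivors : (Fin na → ℕ) → (Fin nb → ℕ × ℕ) → ℕ
    survivors ω ω' = ∑ (allFin na) λ x → ∑ (allFin nb) λ y → ∑ (upTo h) λ i → 𝟙 (survives ω ω' x y i)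

    selection : ∃₂ λ ω ω' → 5 * expected ≤ 8 * (length ps * length qs) * survivors ω ω'
    selection = exists-thinning (2 ^_) (λ i → T * 2 ^ i) a a
      (λ x y → paramsᴬ (χ x y)) (λ x y → paramsᴮ (χ x y)) degreeᴬ degreeᴮ sparseᴬ sparseᴮ

    module Selected (ω : Fin na → ℕ) (ω' : Fin nb → ℕ × ℕ)
      (many : 5 * expected ≤ 8 * (length ps * length qs) * survivors ω ω') where

      S : Fin na → Fin nb → ℕ → Bool
      S = survives ω ω'

      record Survivor (x : Fin na) (y : Fin nb) (i : ℕ) : Set where
        field
          edge     : E x y ≡ true
          raised   : Above i (height x y) (ω x)
          fixed    : height x y ≡ proj₁ (ω' y)
          inside   : window σ T (a i) (χ x y % T) (proj₂ (ω' y)) ≡ true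
          isolated : conflictsᴬ ω ω' x y i + conflictsᴮ ω ω' x y i ≡ 0
          kept     : retained ω ω' x y i ≡ 1
      open Survivor

      survivor : ∀ x y i → S x y i ≡ true → Survivor x y i
      survivor x y i p = record
        { edge     = e
        ; raised   = isAbove⇒Above i (height x y) (ω x) hA
        ; fixed    = from-does (height x y ≟ proj₁ (ω' y)) (proj₁ (∧-true hB))
        ; inside   = proj₂ (∧-true {does (height x y ≟ proj₁ (ω' y))} hB)
        ; isolated = from-does (conflictsᴬ ω ω' x y i + conflictsᴮ ω ω' x y i ≟ 0) (proj₂ (∧-true {hitᴮ (χ x y) i (ω' y)} p₂))
        ; kept     = cong₂ _*_ (cong₂ (λ b b' → 𝟙 b * 𝟙 b') e hA) (cong 𝟙 hB)
        }
        where
        e  = proj₁ (∧-true {E x y} p)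
        p₁ = proj₂ (∧-true {E x y} p)
        hA = proj₁ (∧-true {hitᴬ (χ x y) i (ω x)} p₁)
        p₂ = proj₂ (∧-true {hitᴬ (χ x y) i (ω x)} p₁)
        hB = proj₁ (∧-true {hitᴮ (χ x y) i (ω' y)} p₂)

      other-≢ : ∀ {n} (z z' : Fin n) → z ≢ z' → other z z' ≡ 1
      other-≢ z z' ne with z Fin.≟ z'
      ... | yes eq = contradiction eq ne
      ... | no  _  = refl

      isolatedᴬ : ∀ x y y' i → Survivor x y i → Survivor x y' i → y ≡ y'
      isolatedᴬ x y y' i v v' with y' Fin.≟ y
      ... | yes eq = sym eq
      ... | no  ne = contradiction (begin
          1                                     ≡⟨ cong₂ _*_ (other-≢ y' y ne) (kept v') ⟨
          other y' y * retained ω ω' x y' i     ≤⟨ ∑-member (λ z → other z y * retained ω ω' x z i) (∈-allFin y') ⟩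
          conflictsᴬ ω ω' x y i                 ≤⟨ m≤m+n _ _ ⟩
          conflictsᴬ ω ω' x y i + conflictsᴮ ω ω' x y i ≡⟨ isolated v ⟩
          0                                     ∎) λ ()
        where open ≤-Reasoning

      isolatedᴮ : ∀ x x' y i → Survivor x y i → Survivor x' y i → x ≡ x'
      isolatedᴮ x x' y i v v' with x' Fin.≟ x
      ... | yes eq = sym eq
      ... | no  ne = contradiction (begin
          1                                     ≡⟨ cong₂ _*_ (other-≢ x' x ne) (kept v') ⟨
          other x' x * retained ω ω' x' y i     ≤⟨ ∑-member (λ z → other z x * retained ω ω' z y i) (∈-allFin x') ⟩
          conflictsᴮ ω ω' x y i                 ≤⟨ m≤n+m _ _ ⟩
          conflictsᴬ ω ω' x y i + conflictsᴮ ω ω' x y i ≡⟨ isolated v ⟩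
          0                                     ∎) λ ()
        where open ≤-Reasoning

      class? : ∀ x y → Dec (∃ λ i → i < h × S x y i ≡ true)
      class? x y = anyUpTo? (λ i → S x y i Bool.≟ true) h

      E₁ : EdgeSet na nb
      E₁ x y = does (class? x y)

      D : Colouring na nb
      D x y with class? x y
      ... | yes (i , _) = suc i
      ... | no  _       = 0

      class : ∀ x y → E₁ x y ≡ true → ∃ λ i → i < h × D x y ≡ suc i × Survivor x y i
      class x y e with class? x y
      ... | yes (i , i<h , p) = i , i<h , refl , survivor x y i p

      height-A-dir : ∀ x y y' i i' → Survivor x y i → Survivor x y' i' → i' < i →
        height x y' ≫ i ≡ suc (height x y ≫ i)
      height-A-dir x y y' i i' v v' i'<i = trans (Above-coarse i (raised v') i'<i) (next (raised v))

      -- Both heights are raised to the same `r`, and the one raised at the higher digit is the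
      -- smaller. So `i < i'` would contradict the order of the colours, and `i ≡ i'` contradicts
      -- isolation.
      classes-A : ∀ x y y' i i' → Survivor x y i → Survivor x y' i' → χ x y < χ x y' → i' < i
      classes-A x y y' i i' v v' lt with <-cmp i' i
      ... | tri< i'<i _ _ = i'<i
      ... | tri≈ _ refl _ = contradiction (cong (χ x) (isolatedᴬ x y y' i v v')) (<⇒≢ lt)
      ... | tri> _ _ i<i' = contradiction (≫-mono i' (+-monoˡ-≤ s (≫-mono t (<⇒≤ lt))))
        (<⇒≱ (≤-reflexive (sym (height-A-dir x y' y i' i v' v i<i'))))

      -- Both edges have the height chosen at `y`, so their low halves are ordered like their
      -- colours. A drop of the class would at least double the window, against `window-order`.
      classes-B : ∀ x x' y i i' → i < h → i' < h → Survivor x y i → Survivor x' y i' → Lt σ (χ x y) (χ x' y) → i < i'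
      classes-B x x' y i i' (s≤s i≤h') i'<h v v' lt with <-cmp i i'
      ... | tri< i<i' _ _ = i<i'
      ... | tri≈ _ refl _ = contradiction (subst (λ z → Lt σ (χ x y) (χ z y)) (sym (isolatedᴮ x x' y i v v')) lt) (Lt-irrefl σ)
      ... | tri> _ _ i'<i = contradiction doubled (window-order σ T (a i) (a i') _ _ (proj₂ (ω' y)) (inside v) (inside v')
        (Lt-low σ (+-cancelʳ-≡ s _ _ (trans (fixed v) (sym (fixed v')))) lt))
        where
        open ≤-Reasoning
        doubled : a i + a i ≤ a i'
        doubled = begin
          a i + a i               ≡⟨ cong (a i +_) (+-identityʳ (a i)) ⟨
          2 ^ suc (h' ∸ i)        ≤⟨ ^-monoʳ-≤ 2 (∸-monoʳ-< i'<i i≤h') ⟩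
          a i'                    ∎
        low-mono : ∀ {c c'} → c ≫ t ≡ c' ≫ t → c < c' → c % T < c' % T
        low-mono {c} {c'} eq lt = +-cancelʳ-< (c ≫ t * T) (c % T) (c' % T) (begin-strict
          c % T + c ≫ t * T       ≡⟨ m≡m%n+[m/n]*n c T ⟨
          c                       <⟨ lt ⟩
          c'                      ≡⟨ m≡m%n+[m/n]*n c' T ⟩
          c' % T + c' ≫ t * T     ≡⟨ cong (λ u → c' % T + u * T) eq ⟨
          c' % T + c ≫ t * T      ∎)
        Lt-low : ∀ σ {c c'} → c ≫ t ≡ c' ≫ t → Lt σ c c' → Lt σ (c % T) (c' % T)
        Lt-low true  eq = low-mono eq
        Lt-low false eq = low-mono (sym eq)

      proper : IsProperColouring E₁ h D
      proper = bounds , properᴬ , properᴮ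
        where
        bounds : ∀ x y → E₁ x y ≡ true → 1 ≤ D x y × D x y ≤ h
        bounds x y e with class x y e
        ... | i , i<h , eq , _ = subst (1 ≤_) (sym eq) (s≤s z≤n) , subst (_≤ h) (sym eq) i<h
        properᴬ : ∀ x y y' → E₁ x y ≡ true → E₁ x y' ≡ true → y ≢ y' → D x y ≢ D x y'
        properᴬ x y y' e e' ne eq with class x y e | class x y' e'
        ... | i , _ , p , v | i' , _ , p' , v' = ne (isolatedᴬ x y y' i v
          (subst (Survivor x y') (suc-injective (trans (sym p') (trans (sym eq) p))) v'))
        properᴮ : ∀ x x' y → E₁ x y ≡ true → E₁ x' y ≡ true → x ≢ x' → D x y ≢ D x' y
        properᴮ x x' y e e' ne eq with class x y e | class x' y e'
        ... | i , _ , p , v | i' , _ , p' , v' = ne (isolatedᴮ x x' y i v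
          (subst (Survivor x' y) (suc-injective (trans (sym p') (trans (sym eq) p))) v'))

      survivors-≤ : (∑ (allFin na) λ x → ∑ (allFin nb) λ y → ∑ (upTo h) (λ i → 𝟙 (S x y i))) ≤ edgeCount E₁
      survivors-≤ = ∑-mono (allFin na) λ x → ∑-mono (allFin nb) λ y → at x y
        where
        at : ∀ x y → ∑ (upTo h) (λ i → 𝟙 (S x y i)) ≤ 𝟙 (E₁ x y)
        at x y with class? x y
        -- An edge is counted for one class only, by `Above-unique`.
        ... | yes _ = ∑-upTo-diameter h 1 (S x y) λ i i' p p' → ≤-<-trans
          (≮⇒≥ (Above-unique (raised (survivor x y i p)) (raised (survivor x y i' p')))) (≤-reflexive (+-comm 1 i))
        ... | no none = begin
            ∑ (upTo h) (λ i → 𝟙 (S x y i))  ≤⟨ ∑-mono-∈ (upTo h) (λ i i∈ → zero-at i (∈-upTo⁻ i∈) (S x y i) refl) ⟩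
            ∑ (upTo h) (λ _ → 0)            ≡⟨ trans (∑-const (upTo h) 0) (*-zeroʳ (length (upTo h))) ⟩
            0                               ∎
          where
          open ≤-Reasoning
          zero-at : ∀ i → i < h → ∀ b → S x y i ≡ b → 𝟙 (S x y i) ≤ 0
          zero-at i i<h true  eq = contradiction (i , i<h , eq) none
          zero-at i i<h false eq = ≤-reflexive (cong 𝟙 eq)

      dense : h * edgeCount E ≤ 120 * (d * edgeCount E₁)
      dense = *-cancelˡ-≤ 5 (*-cancelˡ-≤ (2 ^ h') (begin
        2 ^ h' * (5 * (h * edgeCount E))            ≤⟨ *-monoʳ-≤ (2 ^ h') (*-monoʳ-≤ 5 evens-≥) ⟩
        2 ^ h' * (5 * (2 * evens s))                ≡⟨ pull (2 ^ h') (evens s) ⟩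
        2 * (5 * (2 ^ h' * evens s))                ≤⟨ *-monoʳ-≤ 2 (*-monoʳ-≤ 5 expected-≥) ⟩
        2 * (5 * expected)                          ≤⟨ *-monoʳ-≤ 2 many ⟩
        2 * (8 * (length ps * length qs) * survivors ω ω')
          ≤⟨ *-monoʳ-≤ 2 (*-monoʳ-≤ (8 * (length ps * length qs)) survivors-≤) ⟩
        2 * (8 * (length ps * length qs) * edgeCount E₁)
          ≡⟨ cong₂ (λ p q → 2 * (8 * (p * q) * edgeCount E₁)) length-ps length-qs ⟩
        2 * (8 * (4 * 2 ^ h' * (4 * 2 ^ h' * (2 * T))) * edgeCount E₁)
          ≡⟨ collect (2 ^ h') T (edgeCount E₁) ⟩
        2 ^ h' * (256 * (2 * 2 ^ h' * T * edgeCount E₁))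
          ≤⟨ *-monoʳ-≤ (2 ^ h') (*-monoʳ-≤ 256 (*-monoˡ-≤ (edgeCount E₁) M≤2d)) ⟩
        2 ^ h' * (256 * (2 * d * edgeCount E₁))     ≡⟨ cong (2 ^ h' *_) (fold d (edgeCount E₁)) ⟩
        -- The construction gives the factor 512/5, rounded up to 120, which is half of 240.
        2 ^ h' * (512 * (d * edgeCount E₁))         ≤⟨ *-monoʳ-≤ (2 ^ h') (*-monoˡ-≤ (d * edgeCount E₁) (≤ᵇ⇒≤ 512 600 _)) ⟩
        2 ^ h' * (600 * (d * edgeCount E₁))         ≡⟨ cong (2 ^ h' *_) (*-assoc 5 120 (d * edgeCount E₁)) ⟩
        2 ^ h' * (5 * (120 * (d * edgeCount E₁)))   ∎))
        where
        open ≤-Reasoning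
        pull : ∀ H v → H * (5 * (2 * v)) ≡ 2 * (5 * (H * v))
        pull = solve-∀
        collect : ∀ H T e → 2 * (8 * (4 * H * (4 * H * (2 * T))) * e) ≡ H * (256 * (2 * H * T * e))
        collect = solve-∀
        fold : ∀ d e → 256 * (2 * d * e) ≡ 512 * (d * e)
        fold = solve-∀

      thinned-by : Thinned σ E χ d h
      thinned-by = record
        { E₁ = E₁
        ; D = D
        ; height = height
        ; E₁⊆E = λ x y e → edge (proj₂ (proj₂ (proj₂ (class x y e))))
        ; proper = proper
        ; dense = dense
        ; height-mono = λ x y x' y' le → +-monoˡ-≤ s (≫-mono t le)
        ; height-B = λ x x' y e e' → trans (fixed (proj₂ (proj₂ (proj₂ (class x y e))))) (sym (fixed (proj₂ (proj₂ (proj₂ (class x' y e'))))))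
        ; class-B = class-B'
        ; class-A = class-A'
        ; height-A = height-A'
        ; height-A-coarse = height-A-coarse'
        }
        where
        class-B' : ∀ x x' y → E₁ x y ≡ true → E₁ x' y ≡ true → Lt σ (χ x y) (χ x' y) → D x y < D x' y
        class-B' x x' y e e' lt with class x y e | class x' y e'
        ... | i , i< , p , v | i' , i'< , p' , v' = subst₂ _<_ (sym p) (sym p') (s≤s (classes-B x x' y i i' i< i'< v v' lt))
        class-A' : ∀ x y y' → E₁ x y ≡ true → E₁ x y' ≡ true → χ x y < χ x y' → D x y' < D x y
        class-A' x y y' e e' lt with class x y e | class x y' e'
        ... | i , _ , p , v | i' , _ , p' , v' = subst₂ _<_ (sym p') (sym p) (s≤s (classes-A x y y' i i' v v' lt))
        height-A' : ∀ x y y' → E₁ x y ≡ true → E₁ x y' ≡ true → χ x y < χ x y' →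
          level (D x y) (height x y') ≡ suc (level (D x y) (height x y))
        height-A' x y y' e e' lt with class x y e | class x y' e'
        ... | i , _ , p , v | i' , _ , p' , v' = subst (λ D → level D (height x y') ≡ suc (level D (height x y))) (sym p)
          (height-A-dir x y y' i i' v v' (classes-A x y y' i i' v v' lt))
        height-A-coarse' : ∀ x y y' → E₁ x y ≡ true → E₁ x y' ≡ true → χ x y < χ x y' →
          ∀ q → D x y < q → level q (height x y') ≡ level q (height x y)
        height-A-coarse' x y y' e e' lt q D<q with class x y e | class x y' e' | subst (_< q) (proj₁ (proj₂ (proj₂ (class x y e)))) D<q
        ... | i , _ , p , v | i' , _ , p' , v' | s≤s i<q = trans
          (Above-coarse _ (raised v') (<-trans (classes-A x y y' i i' v v' lt) i<q)) (sym (Above-coarse _ (raised v) i<q))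

  thinned : Thinned σ E χ d h
  thinned = Shifted.Selected.thinned-by s s<2^h evens-≥ (proj₁ selection) (proj₁ (proj₂ selection)) (proj₂ (proj₂ selection))
    where
    s       = proj₁ good-shift
    s<2^h   = proj₁ (proj₂ good-shift)
    evens-≥ = proj₂ (proj₂ good-shift)
    selection = Shifted.selection s s<2^h evens-≥

-- Walks

Cmp : ∀ {na nb} → Bool → Vertex na nb → ℕ → ℕ → Set
Cmp σ (inj₁ _) = _<_
Cmp σ (inj₂ _) = Lt σ

-- A walk of length 2(n + 1), seen from its middle vertex: the edges run
-- outwards along the two rays ℓ and ρ.
record Walk {na nb} (σ : Bool) (E : EdgeSet na nb) (χ : Colouring na nb) (n : ℕ) : Set where
  field
    ℓ ρ : ℕ → Vertex na nb
    centre : ℓ 0 ≡ ρ 0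
    adjˡ : ∀ i → i ≤ n → Adj E (ℓ i) (ℓ (suc i))
    adjʳ : ∀ i → i ≤ n → Adj E (ρ i) (ρ (suc i))
    turn  : Cmp σ (ℓ 0) (col χ (ℓ 0) (ℓ 1)) (col χ (ρ 0) (ρ 1))
    stepˡ : ∀ i → i < n → Cmp σ (ℓ (suc i)) (col χ (ℓ i) (ℓ (suc i))) (col χ (ℓ (suc i)) (ℓ (suc (suc i))))
    stepʳ : ∀ i → i < n → Cmp σ (ρ (suc i)) (col χ (ρ i) (ρ (suc i))) (col χ (ρ (suc i)) (ρ (suc (suc i))))
    end   : col χ (ρ n) (ρ (suc n)) ≤ col χ (ℓ n) (ℓ (suc n))

side : ∀ {na nb} → Vertex na nb → Bool
side (inj₁ _) = true
side (inj₂ _) = false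

module _ {na nb : ℕ} where

  private variable
    E : EdgeSet na nb

  Adj-sym : ∀ u v → Adj E u v → Adj E v u
  Adj-sym (inj₁ _) (inj₂ _) e = e
  Adj-sym (inj₂ _) (inj₁ _) e = e

  Adj-side : ∀ u v → Adj E u v → side v ≡ not (side u)
  Adj-side (inj₁ _) (inj₂ _) _ = refl
  Adj-side (inj₂ _) (inj₁ _) _ = refl

  col-sym : ∀ (χ : Colouring na nb) u v → col χ u v ≡ col χ v u
  col-sym χ (inj₁ _) (inj₁ _) = refl
  col-sym χ (inj₁ _) (inj₂ _) = refl
  col-sym χ (inj₂ _) (inj₁ _) = refl
  col-sym χ (inj₂ _) (inj₂ _) = refl

-- Exchanging the two sides of the graph

transpose : ∀ {A : Set} {m n} → (Fin m → Fin n → A) → Fin n → Fin m → A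
transpose f y x = f x y

Adj-transpose : ∀ {na nb} {E : EdgeSet na nb} u v → Adj E u v → Adj (transpose E) (swap u) (swap v)
Adj-transpose (inj₁ _) (inj₂ _) e = e
Adj-transpose (inj₂ _) (inj₁ _) e = e

col-transpose : ∀ {na nb} (χ : Colouring na nb) u v → col χ u v ≡ col (transpose χ) (swap u) (swap v)
col-transpose χ (inj₁ _) (inj₁ _) = refl
col-transpose χ (inj₁ _) (inj₂ _) = refl
col-transpose χ (inj₂ _) (inj₁ _) = refl
col-transpose χ (inj₂ _) (inj₂ _) = refl

edgeCount-transpose : ∀ {na nb} (E : EdgeSet na nb) → edgeCount (transpose E) ≡ edgeCount E
edgeCount-transpose {na} {nb} E = ∑-swap (allFin nb) (allFin na) (λ y x → 𝟙 (E x y))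

proper-transpose : ∀ {na nb} {E : EdgeSet na nb} {d χ} → IsProperColouring E d χ → IsProperColouring (transpose E) d (transpose χ)
proper-transpose (bounds , pᴬ , pᴮ) = (λ y x → bounds x y) , (λ y x x' → pᴮ x x' y) , (λ y y' x → pᴬ x y y')

-- Classes and heights along the two rays of a walk

module _ {na nb : ℕ} {σ : Bool} {d h : ℕ} {E : EdgeSet na nb} {χ : Colouring na nb} (thin : Thinned σ E χ d h)
  (E' : EdgeSet na nb) (E'⊆E₁ : E' ⊆ᴱ Thinned.E₁ thin) where

  open Thinned thin

  private
    -- For either `σ`, classes go down at A and up at B. After exchanging the sides this is the
    -- pattern of `false`.
    class-step : ∀ v u w → Adj E' v u → Adj E' v w → Cmp σ v (col χ v u) (col χ v w) →
      Cmp false (swap v) (col D v u) (col D v w)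
    class-step (inj₁ x) (inj₂ y) (inj₂ y') e e' = class-A x y y' (E'⊆E₁ x y e) (E'⊆E₁ x y' e')
    class-step (inj₂ y) (inj₁ x) (inj₁ x') e e' = class-B x x' y (E'⊆E₁ x y e) (E'⊆E₁ x' y e')

    height-step-B : ∀ v u w → side v ≡ false → Adj E' v u → Adj E' v w → col height v u ≡ col height v w
    height-step-B (inj₂ y) (inj₁ x) (inj₁ x') _ e e' = height-B x x' y (E'⊆E₁ x y e) (E'⊆E₁ x' y e')

    height-step-A : ∀ v u w → side v ≡ true → Adj E' v u → Adj E' v w → Cmp σ v (col χ v u) (col χ v w) →
      level (col D v u) (col height v w) ≡ suc (level (col D v u) (col height v u))
    height-step-A (inj₁ x) (inj₂ y) (inj₂ y') _ e e' = height-A x y y' (E'⊆E₁ x y e) (E'⊆E₁ x y' e')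

    height-step-coarse : ∀ v u w → side v ≡ true → Adj E' v u → Adj E' v w → Cmp σ v (col χ v u) (col χ v w) →
      ∀ q → col D v u < q → level q (col height v w) ≡ level q (col height v u)
    height-step-coarse (inj₁ x) (inj₂ y) (inj₂ y') _ e e' = height-A-coarse x y y' (E'⊆E₁ x y e) (E'⊆E₁ x y' e')

    col-height-mono : ∀ u v u' v' → Adj E' u v → Adj E' u' v' → col χ u v ≤ col χ u' v' → col height u v ≤ col height u' v'
    col-height-mono (inj₁ x) (inj₂ y) (inj₁ x') (inj₂ y') _ _ = height-mono x y x' y'
    col-height-mono (inj₁ x) (inj₂ y) (inj₂ y') (inj₁ x') _ _ = height-mono x y x' y'
    col-height-mono (inj₂ y) (inj₁ x) (inj₁ x') (inj₂ y') _ _ = height-mono x y x' y'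
    col-height-mono (inj₂ y) (inj₁ x) (inj₂ y') (inj₁ x') _ _ = height-mono x y x' y'

    level-< : ∀ q {m n} → level q m < level q n → m < n
    level-< q lt = ≰⇒> (λ n≤m → <⇒≱ lt (≫-mono (pred q) n≤m))

  module _ {n : ℕ} (walk : Walk σ E' χ n) where

    open Walk walk

    private
      hˡ hʳ dˡ dʳ : ℕ → ℕ
      hˡ i = col height (ℓ i) (ℓ (suc i))
      hʳ i = col height (ρ i) (ρ (suc i))
      dˡ i = col D (ℓ i) (ℓ (suc i))
      dʳ i = col D (ρ i) (ρ (suc i))

      backˡ : ∀ i → i ≤ n → Adj E' (ℓ (suc i)) (ℓ i)
      backˡ i i≤n = Adj-sym (ℓ i) (ℓ (suc i)) (adjˡ i i≤n)

      backʳ : ∀ i → i ≤ n → Adj E' (ρ (suc i)) (ρ i)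
      backʳ i i≤n = Adj-sym (ρ i) (ρ (suc i)) (adjʳ i i≤n)

      cmpˡ : ∀ i → i < n → Cmp σ (ℓ (suc i)) (col χ (ℓ (suc i)) (ℓ i)) (col χ (ℓ (suc i)) (ℓ (suc (suc i))))
      cmpˡ i i<n = subst (λ c → Cmp σ (ℓ (suc i)) c (col χ (ℓ (suc i)) (ℓ (suc (suc i))))) (col-sym χ (ℓ i) (ℓ (suc i))) (stepˡ i i<n)

      cmpʳ : ∀ i → i < n → Cmp σ (ρ (suc i)) (col χ (ρ (suc i)) (ρ i)) (col χ (ρ (suc i)) (ρ (suc (suc i))))
      cmpʳ i i<n = subst (λ c → Cmp σ (ρ (suc i)) c (col χ (ρ (suc i)) (ρ (suc (suc i))))) (col-sym χ (ρ i) (ρ (suc i))) (stepʳ i i<n)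

      centreʳ : Adj E' (ℓ 0) (ρ 1)
      centreʳ = subst (λ v → Adj E' v (ρ 1)) (sym centre) (adjʳ 0 z≤n)

      cmp-centre : Cmp σ (ℓ 0) (col χ (ℓ 0) (ℓ 1)) (col χ (ℓ 0) (ρ 1))
      cmp-centre = subst (λ v → Cmp σ (ℓ 0) (col χ (ℓ 0) (ℓ 1)) (col χ v (ρ 1))) (sym centre) turn

      sides : ∀ i → i ≤ n → side (ρ i) ≡ side (ℓ i)
      sides zero    _   = cong side (sym centre)
      sides (suc i) i<n = trans (Adj-side (ρ i) (ρ (suc i)) (adjʳ i (<⇒≤ i<n)))
        (trans (cong not (sides i (<⇒≤ i<n))) (sym (Adj-side (ℓ i) (ℓ (suc i)) (adjˡ i (<⇒≤ i<n)))))

      class-turn : Cmp false (swap (ℓ 0)) (dˡ 0) (dʳ 0)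
      class-turn = subst (λ v → Cmp false (swap (ℓ 0)) (dˡ 0) (col D v (ρ 1))) centre
        (class-step (ℓ 0) (ℓ 1) (ρ 1) (adjˡ 0 z≤n) centreʳ cmp-centre)

      Cmp-transpose : ∀ (v u w u' w' : Vertex na nb) → Cmp false (swap v) (col D u w) (col D u' w') →
        Cmp false (swap v) (col (transpose D) (swap u) (swap w)) (col (transpose D) (swap u') (swap w'))
      Cmp-transpose v u w u' w' = subst₂ (Cmp false (swap v)) (col-transpose D u w) (col-transpose D u' w')

    -- `class-step` supplies every comparison of classes, so the inner part of the walk lacks only
    -- the end condition, which is assumed.
    class-walk : ∀ i → i ≤ n → dʳ i ≤ dˡ i → Walk false (transpose E') (transpose D) i
    class-walk i i≤n le = record
      { ℓ = swap ∘ ℓ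
      ; ρ = swap ∘ ρ
      ; centre = cong swap centre
      ; adjˡ = λ j j≤i → Adj-transpose (ℓ j) (ℓ (suc j)) (adjˡ j (≤-trans j≤i i≤n))
      ; adjʳ = λ j j≤i → Adj-transpose (ρ j) (ρ (suc j)) (adjʳ j (≤-trans j≤i i≤n))
      ; turn = Cmp-transpose (ℓ 0) (ℓ 0) (ℓ 1) (ρ 0) (ρ 1) class-turn
      ; stepˡ = λ j j<i → Cmp-transpose (ℓ (suc j)) (ℓ j) (ℓ (suc j)) (ℓ (suc j)) (ℓ (suc (suc j)))
          (subst (λ c → Cmp false (swap (ℓ (suc j))) c (dˡ (suc j))) (col-sym D (ℓ (suc j)) (ℓ j))
            (class-step (ℓ (suc j)) (ℓ j) (ℓ (suc (suc j))) (backˡ j (below j j<i)) (adjˡ (suc j) (<-≤-trans j<i i≤n)) (cmpˡ j (<-≤-trans j<i i≤n))))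
      ; stepʳ = λ j j<i → Cmp-transpose (ρ (suc j)) (ρ j) (ρ (suc j)) (ρ (suc j)) (ρ (suc (suc j)))
          (subst (λ c → Cmp false (swap (ρ (suc j))) c (dʳ (suc j))) (col-sym D (ρ (suc j)) (ρ j))
            (class-step (ρ (suc j)) (ρ j) (ρ (suc (suc j))) (backʳ j (below j j<i)) (adjʳ (suc j) (<-≤-trans j<i i≤n)) (cmpʳ j (<-≤-trans j<i i≤n))))
      ; end = subst₂ _≤_ (col-transpose D (ρ i) (ρ (suc i))) (col-transpose D (ℓ i) (ℓ (suc i))) le
      }
      where
      below : ∀ j → j < i → j ≤ n
      below j j<i = <⇒≤ (<-≤-trans j<i i≤n)

    module _ (no-class-walk : ∀ i → 1 ≤ i → i < n → ¬ Walk false (transpose E') (transpose D) i) where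

      private
        side-prev : ∀ i → i ≤ n → side (ℓ (suc i)) ≡ true → side (ℓ i) ≡ false
        side-prev i i≤n eq = not-injective (trans (sym (Adj-side (ℓ i) (ℓ (suc i)) (adjˡ i i≤n))) eq)

        -- For `i = 0` the middle vertex lies in B and the turn gives the inequality. Otherwise its
        -- failure would be the end condition of an excluded shorter walk.
        classes-increase : ∀ i → i < n → side (ℓ (suc i)) ≡ true → dˡ i < dʳ i
        classes-increase zero    i<n eq = turn-B (ℓ 0) (side-prev 0 z≤n eq) class-turn
          where
          turn-B : ∀ v {a b} → side v ≡ false → Cmp false (swap v) a b → a < b
          turn-B (inj₂ _) _ lt = lt
        classes-increase (suc i) i<n eq = ≰⇒> (λ le → no-class-walk (suc i) (s≤s z≤n) i<n (class-walk (suc i) (<⇒≤ i<n) le))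

        same-height-ˡ : ∀ i → i < n → side (ℓ (suc i)) ≡ false → hˡ i ≡ hˡ (suc i)
        same-height-ˡ i i<n eq = trans (col-sym height (ℓ i) (ℓ (suc i)))
          (height-step-B (ℓ (suc i)) (ℓ i) (ℓ (suc (suc i))) eq (backˡ i (<⇒≤ i<n)) (adjˡ (suc i) i<n))

        same-height-ʳ : ∀ i → i < n → side (ℓ (suc i)) ≡ false → hʳ i ≡ hʳ (suc i)
        same-height-ʳ i i<n eq = trans (col-sym height (ρ i) (ρ (suc i)))
          (height-step-B (ρ (suc i)) (ρ i) (ρ (suc (suc i))) (trans (sides (suc i) i<n) eq) (backʳ i (<⇒≤ i<n)) (adjʳ (suc i) i<n))

        -- A joint induction outwards: vertices in B pass the inequality on unchanged, and each
        -- vertex in A makes it strict.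
        heights-≤ : ∀ i → i ≤ n → hˡ i ≤ hʳ i
        heights-< : ∀ i → i ≤ n → side (ℓ i) ≡ true → hˡ i < hʳ i

        heights-≤ i i≤n with side (ℓ i) in eq
        heights-≤ i       i≤n | true  = <⇒≤ (heights-< i i≤n eq)
        heights-≤ zero    i≤n | false = ≤-reflexive (trans (height-step-B (ℓ 0) (ℓ 1) (ρ 1) eq (adjˡ 0 z≤n) centreʳ)
          (cong (λ v → col height v (ρ 1)) centre))
        heights-≤ (suc i) i<n | false = subst₂ _≤_ (same-height-ˡ i i<n eq) (same-height-ʳ i i<n eq) (heights-≤ i (<⇒≤ i<n))

        heights-< zero    _   eq = level-< (dˡ 0) (≤-reflexive (sym (subst (λ v → level (dˡ 0) (col height v (ρ 1)) ≡ suc (level (dˡ 0) (hˡ 0)))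
          centre (height-step-A (ℓ 0) (ℓ 1) (ρ 1) eq (adjˡ 0 z≤n) centreʳ cmp-centre))))
        -- At level `q`, the class on the right, the right prefix gains one; the left prefix is
        -- unchanged, because the class on the left is smaller.
        heights-< (suc i) i<n eq = level-< q (begin-strict
            level q (hˡ (suc i))   ≡⟨ height-step-coarse (ℓ (suc i)) (ℓ i) (ℓ (suc (suc i))) eq (backˡ i i≤n) (adjˡ (suc i) i<n) (cmpˡ i i<n) q
                                        (subst (_< q) (col-sym D (ℓ i) (ℓ (suc i))) (classes-increase i i<n eq)) ⟩
            level q (col height (ℓ (suc i)) (ℓ i)) ≡⟨ cong (level q) (col-sym height (ℓ (suc i)) (ℓ i)) ⟩
            level q (hˡ i)         ≤⟨ ≫-mono (pred q) (heights-≤ i i≤n) ⟩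
            level q (hʳ i)         <⟨ n<1+n _ ⟩
            suc (level q (hʳ i))   ≡⟨ cong₂ (λ q h → suc (level q h)) (col-sym D (ρ i) (ρ (suc i))) (col-sym height (ρ i) (ρ (suc i))) ⟩
            suc (level q' (col height (ρ (suc i)) (ρ i))) ≡⟨ height-step-A (ρ (suc i)) (ρ i) (ρ (suc (suc i))) (trans (sides (suc i) i<n) eq) (backʳ i i≤n) (adjʳ (suc i) i<n) (cmpʳ i i<n) ⟨
            level q' (hʳ (suc i))  ≡⟨ cong (λ q → level q (hʳ (suc i))) (col-sym D (ρ (suc i)) (ρ i)) ⟩
            level q (hʳ (suc i))   ∎)
          where
          open ≤-Reasoning
          i≤n = <⇒≤ i<n
          q  = dʳ i
          q' = col D (ρ (suc i)) (ρ i)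

        -- Either the last edge leaves a vertex in A, or it inherits the height of the edge before
        -- it, which does.
        heights-<-end : ∀ m → m < n → hˡ (suc m) < hʳ (suc m)
        heights-<-end m m<n with side (ℓ (suc m)) in eq
        ... | true  = heights-< (suc m) m<n eq
        ... | false = subst₂ _<_ (same-height-ˡ m m<n eq) (same-height-ʳ m m<n eq) (heights-< m (<⇒≤ m<n)
          (not-injective (trans (sym (Adj-side (ℓ m) (ℓ (suc m)) (adjˡ m (<⇒≤ m<n)))) eq)))

      no-walk : 1 ≤ n → ⊥
      no-walk 1≤n with m≤n⇒∃[o]m+o≡n 1≤n
      ... | m , eq = <⇒≱ (subst (λ i → hˡ i < hʳ i) eq (heights-<-end m (≤-reflexive eq)))
        (col-height-mono (ρ n) (ρ (suc n)) (ℓ n) (ℓ (suc n)) (adjʳ n ≤-refl) (adjˡ n ≤-refl) end)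

-- Iterated logarithms

-- The least a with x < 2 ^ a: an integer stand-in for log x, rounded up.
bitLength : ℕ → ℕ
bitLength zero    = 0
bitLength (suc x) with suc x <? 2 ^ bitLength x
... | yes _ = bitLength x
... | no  _ = suc (bitLength x)

<2^bitLength : ∀ x → x < 2 ^ bitLength x
<2^bitLength zero    = s≤s z≤n
<2^bitLength (suc x) with suc x <? 2 ^ bitLength x
... | yes p = p
... | no  _ = begin
    suc (suc x)                    ≤⟨ +-mono-≤ (m^n>0 2 (bitLength x)) (<2^bitLength x) ⟩
    2 ^ bitLength x + 2 ^ bitLength x   ≡⟨ cong (2 ^ bitLength x +_) (+-identityʳ _) ⟨
    2 ^ suc (bitLength x)          ∎
  where open ≤-Reasoning

bitLength-least : ∀ x a → x < 2 ^ a → bitLength x ≤ a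
bitLength-least zero    a _ = z≤n
bitLength-least (suc x) a lt with suc x <? 2 ^ bitLength x
... | yes _ = bitLength-least x a (<-trans (n<1+n x) lt)
... | no ¬p = ≰⇒> (λ a≤ → ¬p (<-≤-trans lt (^-monoʳ-≤ 2 a≤)))

2^pred-bitLength : ∀ x m → bitLength x ≡ suc m → 2 ^ m ≤ x
2^pred-bitLength x m eq = ≮⇒≥ (λ lt → 1+n≰n (subst (_≤ m) eq (bitLength-least x m lt)))

bitLength-mono : ∀ {x y} → x ≤ y → bitLength x ≤ bitLength y
bitLength-mono {x} {y} x≤y = bitLength-least x _ (≤-<-trans x≤y (<2^bitLength y))

bitLength-pos : ∀ {x} → 1 ≤ x → 1 ≤ bitLength x
bitLength-pos {x} 1≤x = ≰⇒> (λ le → <⇒≱ (<2^bitLength x) (subst (λ b → 2 ^ b ≤ x) (sym (n≤0⇒n≡0 le)) 1≤x))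

bitLength-double : ∀ {x} → 1 ≤ x → bitLength (2 * x) ≤ 2 * bitLength x
bitLength-double {x} 1≤x = bitLength-least (2 * x) _ (begin-strict
  2 * x                        <⟨ *-monoʳ-< 2 (<2^bitLength x) ⟩
  2 ^ suc (bitLength x)        ≤⟨ ^-monoʳ-≤ 2 (+-monoˡ-≤ (bitLength x) (bitLength-pos 1≤x)) ⟩
  2 ^ (bitLength x + bitLength x)   ≡⟨ cong (λ b → 2 ^ (bitLength x + b)) (+-identityʳ (bitLength x)) ⟨
  2 ^ (2 * bitLength x)        ∎)
  where open ≤-Reasoning

bitLengths : ℕ → ℕ → ℕ
bitLengths zero    x = x
bitLengths (suc j) x = bitLength (bitLengths j x)

bitLengths-suc : ∀ j x → bitLengths (suc j) x ≡ bitLengths j (bitLength x)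
bitLengths-suc zero    x = refl
bitLengths-suc (suc j) x = cong bitLength (bitLengths-suc j x)

bitLengths-pos : ∀ j {x} → 1 ≤ x → 1 ≤ bitLengths j x
bitLengths-pos zero    p = p
bitLengths-pos (suc j) p = bitLength-pos (bitLengths-pos j p)

bitLengths-mono : ∀ j {x y} → x ≤ y → bitLengths j x ≤ bitLengths j y
bitLengths-mono zero    p = p
bitLengths-mono (suc j) p = bitLength-mono (bitLengths-mono j p)

-- Doubling adds one to a logarithm, hence at most doubles a bit length. So the loss from halving
-- the digits stays a factor of 2 under iteration.
bitLengths-double : ∀ j {x} → 1 ≤ x → bitLengths j (2 * x) ≤ 2 * bitLengths j x
bitLengths-double zero    p = ≤-refl
bitLengths-double (suc j) p = ≤-trans (bitLength-mono (bitLengths-double j p)) (bitLength-double (bitLengths-pos j p))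

-- Serves the case of a single colour, which is measured by `suc d`, that is by 2.
bitLengths-2 : ∀ j → bitLengths j 2 ≡ 2
bitLengths-2 zero    = refl
bitLengths-2 (suc j) = cong bitLength (bitLengths-2 j)

-- Strictness starts from `d < suc d` and persists by `m < 2 ^ bitLength m`. The rational that
-- separates the two sides is the integer `m`, with denominator 1.
bitLengths⇒LogLt : ∀ j d a b → 1 ≤ b → bitLengths j (suc d) * b ≤ a → LogLt j d a b
bitLengths⇒LogLt zero    d a b 1≤b le = ≤-trans (+-monoˡ-≤ (d * b) 1≤b) le
bitLengths⇒LogLt (suc j) d a b 1≤b le =
  m , 1 , bitLengths-pos j (s≤s z≤n) , s≤s z≤n , bitLengths⇒LogLt j d m 1 (s≤s z≤n) (≤-reflexive (*-identityʳ m)) , (begin-strict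
    m ^ b                  <⟨ ^-monoˡ-< b {{>-nonZero 1≤b}} (<2^bitLength m) ⟩
    (2 ^ bitLength m) ^ b  ≡⟨ ^-*-assoc 2 (bitLength m) b ⟩
    2 ^ (bitLength m * b)  ≤⟨ ^-monoʳ-≤ 2 le ⟩
    2 ^ a                  ≡⟨ *-identityʳ (2 ^ a) ⟨
    2 ^ a * 1              ≡⟨ cong (2 ^ a *_) (^-zeroˡ b) ⟨
    2 ^ a * 1 ^ b          ∎)
  where
  open ≤-Reasoning
  m = bitLengths j (suc d)

-- Iterated thinning

-- The bits of `d` are cut in the middle; as `2 ≤ d` there are two of them, so `h` is positive. The
-- bound is in terms of `suc h` because the recursion measures `h` colours by `suc h`.
thinning : ∀ {na nb} σ (E : EdgeSet na nb) χ d → IsProperColouring E d χ → 2 ≤ d →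
  ∃ λ h → 1 ≤ h × bitLength (suc d) ≤ 2 * suc h × Thinned σ E χ d h
thinning σ E χ d isProper 2≤d = go ⌊ m /2⌋ ⌈ m /2⌉ (⌊n/2⌋+⌈n/2⌉≡n m) (⌊n/2⌋≤⌈n/2⌉ m) (⌊n/2⌋-mono (n≤1+n (suc m))) (⌊n/2⌋-mono 2≤m)
  where
  open ≤-Reasoning
  m = bitLength d
  2≤m : 2 ≤ m
  2≤m = bitLength-mono 2≤d
  go : ∀ h t → h + t ≡ m → h ≤ t → t ≤ suc h → 1 ≤ h → ∃ λ h → 1 ≤ h × bitLength (suc d) ≤ 2 * suc h × Thinned σ E χ d h
  go (suc h') t h+t≡m h≤t t≤1+h 1≤h = suc h' , 1≤h , bitLength-least (suc d) (2 * suc (suc h')) log-bound ,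
    Construction.thinned σ E χ d h' t isProper h≤t (subst (d <_) M≡ (<2^bitLength d)) (begin
      2 ^ suc h' * 2 ^ t     ≡⟨ ^-distribˡ-+-* 2 (suc h') t ⟨
      2 * 2 ^ (h' + t)       ≤⟨ *-monoʳ-≤ 2 (2^pred-bitLength d (h' + t) (sym h+t≡m)) ⟩
      2 * d                  ∎)
    where
    M≡ : 2 ^ m ≡ 2 ^ suc h' * 2 ^ t
    M≡ = trans (cong (2 ^_) (sym h+t≡m)) (^-distribˡ-+-* 2 (suc h') t)
    log-bound : suc d < 2 ^ (2 * suc (suc h'))
    log-bound = begin-strict
      suc d                       <⟨ s≤s (<2^bitLength d) ⟩
      1 + 2 ^ m                   ≤⟨ +-monoˡ-≤ (2 ^ m) (m^n>0 2 m) ⟩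
      2 ^ m + 2 ^ m               ≡⟨ cong (2 ^ m +_) (+-identityʳ (2 ^ m)) ⟨
      2 ^ suc m                   ≡⟨ cong (λ k → 2 ^ suc k) h+t≡m ⟨
      2 ^ (suc (suc h') + t)      ≤⟨ ^-monoʳ-≤ 2 (+-monoʳ-≤ (suc (suc h')) (≤-trans t≤1+h (≤-reflexive (sym (+-identityʳ (suc (suc h'))))))) ⟩
      2 ^ (2 * suc (suc h'))      ∎

-- The two middle edges of a walk have different colours.
one-colour : ∀ {na nb} {σ} {E : EdgeSet na nb} {χ n} → IsProperColouring E 1 χ → ¬ Walk σ E χ n
one-colour {σ = σ} {E} {χ} (bounds , _) walk = irreflexive (ℓ 0) (subst₂ (Cmp σ (ℓ 0)) (colour (ℓ 0) (ℓ 1) (adjˡ 0 z≤n)) (colour (ρ 0) (ρ 1) (adjʳ 0 z≤n)) turn)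
  where
  open Walk walk
  colour : ∀ u v → Adj E u v → col χ u v ≡ 1
  colour (inj₁ x) (inj₂ y) e = ≤-antisym (proj₂ (bounds x y e)) (proj₁ (bounds x y e))
  colour (inj₂ y) (inj₁ x) e = ≤-antisym (proj₂ (bounds x y e)) (proj₁ (bounds x y e))
  irreflexive : ∀ v → ¬ Cmp σ v 1 1
  irreflexive (inj₁ _) = <-irrefl refl
  irreflexive (inj₂ _) = Lt-irrefl σ

-- Induction on the number of thinnings. An arbitrary `σ` occurs at the first level only; below it
-- the sides are exchanged and `σ` is `false`.
walk-free-subgraph : ∀ j {na nb} σ (E : EdgeSet na nb) χ d → IsProperColouring E d χ → 1 ≤ d →
  Σ (EdgeSet na nb) λ E' → E' ⊆ᴱ E × (∀ n → 1 ≤ n → n ≤ j → ¬ Walk σ E' χ n)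
    × bitLengths j (suc d) * edgeCount E ≤ 4 * 240 ^ j * d * edgeCount E'
walk-free-subgraph zero σ E χ d isProper 1≤d = E , (λ _ _ e → e) , (λ n 1≤n n≤0 → contradiction (≤-trans 1≤n n≤0) λ ()) ,
  -- The factor 4 covers `suc d ≤ d + d`.
  *-monoˡ-≤ (edgeCount E) (≤-trans (+-monoˡ-≤ d 1≤d) (+-monoʳ-≤ d (m≤m+n d (d + (d + 0)))))
walk-free-subgraph (suc j) σ E χ (suc zero) isProper _ = E , (λ _ _ e → e) , (λ _ _ _ → one-colour isProper) ,
  *-monoˡ-≤ (edgeCount E) (begin
    bitLengths (suc j) 2        ≡⟨ bitLengths-2 (suc j) ⟩
    2                           ≤⟨ s≤s (s≤s z≤n) ⟩
    4 * 1 * 1                   ≤⟨ *-monoˡ-≤ 1 (*-monoʳ-≤ 4 (m^n>0 240 (suc j))) ⟩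
    4 * 240 ^ suc j * 1         ∎)
  where open ≤-Reasoning
walk-free-subgraph (suc j) {na} {nb} σ E χ d@(suc (suc _)) isProper _ = E' , E'⊆E , walk-free , dense-enough
  where
  thinned = thinning σ E χ d isProper (s≤s (s≤s z≤n))
  h   = proj₁ thinned
  1≤h = proj₁ (proj₂ thinned)
  open Thinned (proj₂ (proj₂ (proj₂ thinned)))
  rest = walk-free-subgraph j false (transpose E₁) (transpose D) h (proper-transpose proper) 1≤h
  E' : EdgeSet na nb
  E' = transpose (proj₁ rest)
  E'⊆E₁ : E' ⊆ᴱ E₁
  E'⊆E₁ x y = proj₁ (proj₂ rest) y x
  E'⊆E : E' ⊆ᴱ E
  E'⊆E x y e = E₁⊆E x y (E'⊆E₁ x y e)
  walk-free : ∀ n → 1 ≤ n → n ≤ suc j → ¬ Walk σ E' χ n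
  walk-free n 1≤n n≤1+j walk = no-walk (proj₂ (proj₂ (proj₂ thinned))) E' E'⊆E₁ walk
    (λ i 1≤i i<n → proj₁ (proj₂ (proj₂ rest)) i 1≤i (s≤s⁻¹ (<-≤-trans i<n n≤1+j))) 1≤n
  ℬ = bitLengths j (suc h)
  rest-dense : ℬ * edgeCount E₁ ≤ 4 * 240 ^ j * h * edgeCount E'
  rest-dense = subst₂ (λ e e' → ℬ * e ≤ 4 * 240 ^ j * h * e') (edgeCount-transpose E₁) (sym (edgeCount-transpose (proj₁ rest)))
    (proj₂ (proj₂ (proj₂ rest)))
  logs : bitLengths (suc j) (suc d) ≤ 2 * ℬ
  logs = begin
    bitLengths (suc j) (suc d)        ≡⟨ bitLengths-suc j (suc d) ⟩
    bitLengths j (bitLength (suc d))  ≤⟨ bitLengths-mono j (proj₁ (proj₂ (proj₂ thinned))) ⟩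
    bitLengths j (2 * suc h)          ≤⟨ bitLengths-double j (s≤s z≤n) ⟩
    2 * ℬ                             ∎
    where open ≤-Reasoning
  dense-enough : bitLengths (suc j) (suc d) * edgeCount E ≤ 4 * 240 ^ suc j * d * edgeCount E'
  -- The gain `h` of the thinning cancels the loss `h` of the recursive bound for `h` colours; 240
  -- is 120 times the 2 from `logs`.
  dense-enough = *-cancelˡ-≤ h {{>-nonZero 1≤h}} (begin
    h * (bitLengths (suc j) (suc d) * edgeCount E)  ≤⟨ *-monoʳ-≤ h (*-monoˡ-≤ (edgeCount E) logs) ⟩
    h * (2 * ℬ * edgeCount E)                       ≡⟨ pull h ℬ (edgeCount E) ⟩
    2 * ℬ * (h * edgeCount E)                       ≤⟨ *-monoʳ-≤ (2 * ℬ) dense ⟩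
    2 * ℬ * (120 * (d * edgeCount E₁))              ≡⟨ collect ℬ d (edgeCount E₁) ⟩
    240 * d * (ℬ * edgeCount E₁)                    ≤⟨ *-monoʳ-≤ (240 * d) rest-dense ⟩
    240 * d * (4 * 240 ^ j * h * edgeCount E')      ≡⟨ arrange d (240 ^ j) h (edgeCount E') ⟩
    h * (4 * 240 ^ suc j * d * edgeCount E')        ∎)
    where
    open ≤-Reasoning
    pull : ∀ h b e → h * (2 * b * e) ≡ 2 * b * (h * e)
    pull = solve-∀
    collect : ∀ b d e → 2 * b * (120 * (d * e)) ≡ 240 * d * (b * e)
    collect = solve-∀
    arrange : ∀ d p h e → 240 * d * (4 * p * h * e) ≡ h * (4 * (240 * p) * d * e)
    arrange = solve-∀

-- Fast and slow walks

-- `first` compares against the direction of `w`, because the left ray runs from `w (suc n)` back to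
-- `w 0`.
module _ {na nb : ℕ} {σ : Bool} {E : EdgeSet na nb} {χ : Colouring na nb} {n : ℕ} (w : ℕ → Vertex na nb)
  (isWalk : IsWalk E (2 * suc n) w)
  (first  : ∀ j → 1 ≤ j → j < suc n → Cmp σ (w j) (walkColour χ w (suc j)) (walkColour χ w j))
  (second : ∀ j → suc n ≤ j → j < 2 * suc n → Cmp σ (w j) (walkColour χ w j) (walkColour χ w (suc j)))
  (ends   : walkColour χ w (2 * suc n) ≤ walkColour χ w 1) where

  private
    k = suc n
    ℓ ρ : ℕ → Vertex na nb
    ℓ i = w (k ∸ i)
    ρ i = w (i + k)

    k∸suc : ∀ i → i ≤ n → k ∸ i ≡ suc (k ∸ suc i)
    k∸suc i i≤n = +-∸-assoc 1 i≤n

    colourˡ : ∀ i → i ≤ n → col χ (ℓ i) (ℓ (suc i)) ≡ walkColour χ w (k ∸ i)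
    colourˡ i i≤n = trans (col-sym χ (ℓ i) (ℓ (suc i))) (sym (cong (λ m → col χ (w m) (w (k ∸ i))) (cong pred (k∸suc i i≤n))))

    k+≤ : ∀ i → i ≤ n → suc (i + k) ≤ 2 * k
    k+≤ i i≤n = ≤-trans (+-monoˡ-≤ k (s≤s i≤n)) (≤-reflexive (cong (k +_) (sym (+-identityʳ k))))

  outward : Walk σ E χ n
  outward = record
    { ℓ = ℓ
    ; ρ = ρ
    ; centre = refl
    ; adjˡ = λ i i≤n → Adj-sym (ℓ (suc i)) (ℓ i) (subst (λ m → Adj E (w (k ∸ suc i)) (w m)) (sym (k∸suc i i≤n))
        (proj₁ isWalk (suc (k ∸ suc i)) (s≤s z≤n) (subst (_≤ 2 * k) (k∸suc i i≤n) (≤-trans (m∸n≤m k i) (m≤m+n k (k + 0))))))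
    ; adjʳ = λ i i≤n → proj₁ isWalk (suc (i + k)) (s≤s z≤n) (k+≤ i i≤n)
    ; turn = subst (λ c → Cmp σ (ℓ 0) c (walkColour χ w (suc k))) (sym (colourˡ 0 z≤n)) (second k ≤-refl (k+≤ 0 z≤n))
    ; stepˡ = λ i i<n → subst₂ (Cmp σ (ℓ (suc i))) (trans (cong (walkColour χ w) (sym (k∸suc i (<⇒≤ i<n)))) (sym (colourˡ i (<⇒≤ i<n))))
        (sym (colourˡ (suc i) i<n)) (first (k ∸ suc i) (m<n⇒0<n∸m i<n) (s≤s (m∸n≤m n i)))
    ; stepʳ = λ i i<n → second (suc i + k) (m≤n+m k (suc i)) (k+≤ (suc i) i<n)
    ; end = subst₂ _≤_ (cong (walkColour χ w) (cong (k +_) (+-identityʳ k)))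
        (trans (cong (walkColour χ w) (sym (m+n∸n≡m 1 n))) (sym (colourˡ n ≤-refl))) ends
    }

fast⇒Walk : ∀ {na nb} {E : EdgeSet na nb} {χ n} → HasFastWalk E χ (suc n) → Walk true E χ n
fast⇒Walk (w , isWalk , down , up , ends) = outward w isWalk
  (λ j 1≤j j<k → any-side (w j) (down j 1≤j j<k)) (λ j k≤j j<2k → any-side (w j) (up j k≤j j<2k)) ends
  where
  any-side : ∀ v {a b} → a < b → Cmp true v a b
  any-side (inj₁ _) lt = lt
  any-side (inj₂ _) lt = lt

-- A walk from B is in B exactly at even positions, so the parities in the slow pattern tell the
-- sides apart. Read from the middle, its inequalities become increase at A and decrease at B.
slow⇒Walk : ∀ {na nb} {E : EdgeSet na nb} {χ n} → HasSlowBWalk E χ (suc n) → Walk false E χ n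
slow⇒Walk {E = E} {χ} {n} (w , startB , isWalk , downᴬ , upᴮ , upᴬ , downᴮ , ends) = outward w isWalk first second ends
  where
  k = suc n
  c = walkColour χ w

  side-start : ∀ v → StartsInB v → side v ≡ false
  side-start (inj₂ _) _ = refl

  side-at : ∀ i → i ≤ 2 * k → side (w i) ≡ not (isEven i)
  side-at zero    _  = side-start (w 0) startB
  side-at (suc i) le = trans (Adj-side (w i) (w (suc i)) (proj₁ isWalk (suc i) (s≤s z≤n) le)) (cong not (side-at i (<⇒≤ le)))

  at-A : ∀ v {a b} → side v ≡ true → a < b → Cmp false v a b
  at-A (inj₁ _) _ lt = lt
  at-B : ∀ v {a b} → side v ≡ false → b < a → Cmp false v a b
  at-B (inj₂ _) _ lt = lt

  double : ∀ j → isEven j ≡ true → ∃ λ a → j ≡ 2 * a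
  double j ev with isEven⇒double j ev
  ... | a , eq = a , trans eq (*-comm a 2)

  k≤2k : k ≤ 2 * k
  k≤2k = m≤m+n k (k + 0)

  first : ∀ j → 1 ≤ j → j < k → Cmp false (w j) (c (suc j)) (c j)
  first j 1≤j j<k with isEven j in ev
  ... | true with double j ev
  ...   | suc a , refl = at-B (w j) (trans (side-at j (<⇒≤ (<-≤-trans j<k k≤2k))) (cong not ev))
    (subst (λ m → c j < c m) (+-comm j 1) (upᴮ (suc a) (s≤s z≤n) j<k))
  first j 1≤j j<k | false with double (suc j) (cong not ev)
  ...   | suc a , eq = at-A (w j) (trans (side-at j (<⇒≤ (<-≤-trans j<k k≤2k))) (cong not ev))
    (subst₂ (λ m m' → c m < c m') (sym eq) (cong pred (sym eq)) (downᴬ (suc a) (s≤s z≤n) (subst (_≤ k) eq j<k)))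

  second : ∀ j → k ≤ j → j < 2 * k → Cmp false (w j) (c j) (c (suc j))
  second j k≤j j<2k with isEven j in ev
  ... | true with double j ev
  ...   | a , refl = at-B (w j) (trans (side-at j (<⇒≤ j<2k)) (cong not ev))
    (subst (λ m → c m < c j) (+-comm j 1) (downᴮ a k≤j (*-cancelˡ-< 2 a k j<2k)))
  second j k≤j j<2k | false with double (suc j) (cong not ev)
  ...   | suc a , eq = at-A (w j) (trans (side-at j (<⇒≤ j<2k)) (cong not ev))
    (subst₂ (λ m m' → c m < c m') (cong pred (sym eq)) (sym eq)
      (upᴬ (suc a) (subst (k <_) eq (s≤s k≤j)) (*-cancelˡ-≤ 2 (subst (_≤ 2 * k) eq j<2k))))

edge⇒1≤d : ∀ {na nb} {E : EdgeSet na nb} {χ} d → IsProperColouring E d χ → 1 ≤ edgeCount E → 1 ≤ d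
edge⇒1≤d (suc d) _ _ = s≤s z≤n
edge⇒1≤d {na} {nb} {E} zero (bounds , _) 1≤e = contradiction (≤-trans 1≤e (begin
  edgeCount E                                        ≤⟨ ∑-mono (allFin na) (λ x → ∑-mono (allFin nb) (λ y → absent x y (E x y) refl)) ⟩
  ∑ (allFin na) (λ _ → ∑ (allFin nb) (λ _ → 0))      ≡⟨ ∑-cong (allFin na) (λ _ → trans (∑-const (allFin nb) 0) (*-zeroʳ (length (allFin nb)))) ⟩
  ∑ (allFin na) (λ _ → 0)                            ≡⟨ trans (∑-const (allFin na) 0) (*-zeroʳ (length (allFin na))) ⟩
  0                                                  ∎)) λ ()
  where
  open ≤-Reasoning
  absent : ∀ x y b → E x y ≡ b → 𝟙 (E x y) ≤ 0
  absent x y true  e = contradiction (≤-trans (proj₁ (bounds x y e)) (proj₂ (bounds x y e))) λ ()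
  absent x y false e = ≤-reflexive (cong 𝟙 e)

theorem10 : (na nb d : ℕ) (E : EdgeSet na nb) (χ : Colouring na nb) (k : ℕ) →
    IsProperColouring E d χ → 2 ≤ k → 1 ≤ edgeCount E →
    (Σ (EdgeSet na nb) λ E' → E' ⊆ᴱ E
    × (∀ k' → 2 ≤ k' → k' ≤ k → ¬ HasSlowBWalk E' χ k')
    × LogLt (k ∸ 1) d (4 * 240 ^ (k ∸ 1) * d * edgeCount E') (edgeCount E))
    × (Σ (EdgeSet na nb) λ E'' → E'' ⊆ᴱ E
    × (∀ k' → 2 ≤ k' → k' ≤ k → ¬ HasFastWalk E'' χ k')
    × LogLt (k ∸ 1) d (4 * 240 ^ (k ∸ 1) * d * edgeCount E'') (edgeCount E))
theorem10 na nb d E χ (suc j) isProper _ 1≤e =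
  subgraph false HasSlowBWalk (λ n E' → slow⇒Walk) , subgraph true HasFastWalk (λ n E' → fast⇒Walk)
  where
  subgraph : ∀ σ (Has : EdgeSet na nb → Colouring na nb → ℕ → Set) → (∀ n E' → Has E' χ (suc n) → Walk σ E' χ n) →
    Σ (EdgeSet na nb) λ E' → E' ⊆ᴱ E × (∀ k' → 2 ≤ k' → k' ≤ suc j → ¬ Has E' χ k')
      × LogLt j d (4 * 240 ^ j * d * edgeCount E') (edgeCount E)
  subgraph σ Has toWalk with walk-free-subgraph j σ E χ d isProper (edge⇒1≤d d isProper 1≤e)
  -- A walk of length `2 * k'` has index `n` with `k' ≡ suc n`, so `2 ≤ k' ≤ k` becomes `1 ≤ n ≤ j`.
  ... | E' , sub , free , le = E' , sub , (λ { (suc n) (s≤s 1≤n) (s≤s n≤j) has → free n 1≤n n≤j (toWalk n E' has) }) ,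
    bitLengths⇒LogLt j d _ (edgeCount E) 1≤e le
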